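{- Let $D$ be a strongly connected balanced bipartite digraph with partite sets $V_1,V_2$ with $|V_1|=|V_2|=a$, where $a\geq 3$. Suppose that $d(x)+d(y)\geq 3a$ for every pair of distinct vertices $x,y$ of $D$ which have a common in-neighbour or a common out-neighbour. Then $D$ is hamiltonian. Moreover, the only non-hamiltonian strongly connected balanced bipartite digraph on $4$ vertices (i.e. with $a=2$) satisfying $d(x)+d(y)\geq 3a$ for every pair of vertices $x,y$ with a common in-neighbour or a common out-neighbour is (up to isomorphism) the digraph obtained from the complete bipartite digraph $\stackrel{\leftrightarrow}{K}_{2,2}$ by removing one $2$-cycle (i.e. removing both arcs $uv$ and $vu$ for one pair $u\in V_1$, $v\in V_2$).
   Context: Digraphs are finite, with no loops and no multiple arcs. For a vertex $v$, $d^+(v)$ (resp. $d^-(v)$) is the number of out-neighbours (resp. in-neighbours) of $v$, and $d(v)=d^+(v)+d^-(v)$. An in-neighbour of $u$ is a vertex $v$ with $vu$ an arc; an out-neighbour of $u$ is a vertex $v$ with $uv$ an arc. A bipartite digraph has vertex set the disjoint union of two independent sets (partite sets); it is balanced if they have equal size. $\stackrel{\leftrightarrow}{K}_{2,2}$ is the bipartite digraph with partite sets of size $2$ containing both arcs $xy$ and $yx$ for all $x,y$ in different partite sets. A digraph is hamiltonian if it contains a directed cycle through all its vertices; it is strongly connected if for all vertices $u,v$ there is a directed path from $u$ to $v$. -}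

module Defs where

open import Data.Bool using (Bool; true; false; T; not; _∧_; _∨_)
open import Data.Nat using (ℕ; zero; suc; _+_; _*_; _≤_)
open import Data.Fin using (Fin; toℕ; zero; suc)
open import Data.List using (List; length; filter; allFin)
open import Data.Product using (Σ; ∃; _×_; _,_)
open import Data.Sum using (_⊎_)
open import Relation.Nullary using (¬_)
open import Relation.Nullary.Decidable using (T?)
open import Relation.Binary.PropositionalEquality using (_≡_; _≢_)
open import Relation.Binary.Construct.Closure.ReflexiveTransitive using (Star)
open import Function.Definitions using (Bijective)

record Digraph (n : ℕ) : Set where
  field
    arc      : Fin n → Fin n → Bool
    loopless : ∀ v → arc v v ≡ false
open Digraph public

#[_] : {n : ℕ} → (Fin n → Bool) → ℕ
#[_] {n} p = length (filter (λ u → T? (p u)) (allFin n))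

d⁺ : {n : ℕ} → Digraph n → Fin n → ℕ
d⁺ D v = #[ (λ u → arc D v u) ]

d⁻ : {n : ℕ} → Digraph n → Fin n → ℕ
d⁻ D v = #[ (λ u → arc D u v) ]

deg : {n : ℕ} → Digraph n → Fin n → ℕ
deg D v = d⁺ D v + d⁻ D v

BalancedBipartite : {n : ℕ} → Digraph n → (side : Fin n → Bool) → ℕ → Set
BalancedBipartite D side a =
  (∀ u v → T (arc D u v) → side u ≢ side v)
  × #[ side ] ≡ a
  × #[ (λ v → not (side v)) ] ≡ a

StronglyConnected : {n : ℕ} → Digraph n → Set
StronglyConnected D = ∀ u v → Star (λ x y → T (arc D x y)) u v

-- a directed cycle through all vertices: an enumeration c of all vertices
-- (a bijection Fin n → Fin n) with arcs c(i) → c(i+1) and c(n-1) → c(0)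
Hamiltonian : {n : ℕ} → Digraph n → Set
Hamiltonian {n} D =
  Σ (Fin n → Fin n) λ c → Bijective _≡_ _≡_ c ×
    (∀ i j → (suc (toℕ i) ≡ toℕ j ⊎ (suc (toℕ i) ≡ n × toℕ j ≡ 0))
           → T (arc D (c i) (c j)))

CommonNeighbour : {n : ℕ} → Digraph n → Fin n → Fin n → Set
CommonNeighbour D x y =
  (∃ λ z → T (arc D z x) × T (arc D z y)) ⊎ (∃ λ z → T (arc D x z) × T (arc D y z))

DegreeCondition : {n : ℕ} → Digraph n → ℕ → Set
DegreeCondition D a =
  ∀ x y → x ≢ y → CommonNeighbour D x y → 3 * a ≤ deg D x + deg D y

Isomorphic : {n m : ℕ} → Digraph n → Digraph m → Set
Isomorphic {n} {m} D E =
  Σ (Fin n → Fin m) λ f → Bijective _≡_ _≡_ f × (∀ x y → arc D x y ≡ arc E (f x) (f y))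

side22 : Fin 4 → Bool
side22 zero = true
side22 (suc zero) = true
side22 (suc (suc _)) = false

differ : Bool → Bool → Bool
differ true b = not b
differ false b = b

K22-arc : Fin 4 → Fin 4 → Bool
K22-arc u v = differ (side22 u) (side22 v)

is02 : Fin 4 → Fin 4 → Bool
is02 zero (suc (suc zero)) = true
is02 (suc (suc zero)) zero = true
is02 _ _ = false

K22-minus-2cycle : Digraph 4
K22-minus-2cycle = record
  { arc = λ u v → K22-arc u v ∧ not (is02 u v)
  ; loopless = λ { zero → _≡_.refl ; (suc zero) → _≡_.refl
                 ; (suc (suc zero)) → _≡_.refl ; (suc (suc (suc zero))) → _≡_.refl } }

{-# OPTIONS --safe #-}

-- A cycle factor of D is a permutation σ with arcs u ⟶ σ u; its cycles are the orbits of σ.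
--
-- Factor: take a permutation exchanging the two sides with as many arcs x ⟶ σ x as possible.  If x ⟶ σ x fails,
-- then neither a transposition nor a rotation of three images may help, which makes out- and in-neighbourhoods
-- disjoint; with the degree condition this yields both d⁻(σ x) < d⁺(x) and d⁺(x) < d⁻(σ x).
--
-- Merging: take a factor with a maximal orbit relation.  For u, z on different orbits u ⟶ σ z and z ⟶ σ u exclude
-- each other, so d⁺(u) + d⁻(σ u) ≤ a + m, where m is the number of vertices of the orbit on the side of u.
-- If there are two orbits, then (a ≥ 3) every degree is at least a, no orbit is a 2-cycle, and any two vertices on
-- the same side have a common neighbour, so d(x) + d(y) ≥ 3a holds for all such pairs.  Averaging over an orbit with
-- 2m ≤ a forces 2m = a and equality everywhere: the orbits are two complete bipartite halves, between which, on
-- either side, all arcs go one way.  Strong connectivity then leaves two vertices of degree a on one side.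

module Submission where

open import Defs
open import Data.Bool using (Bool; true; false; T; not)
open import Data.Bool.Properties using (T?; ¬-not; not-involutive) renaming (_≟_ to _≟ᵇ_)
open import Data.Empty using (⊥; ⊥-elim)
open import Data.Fin using (Fin; zero; suc; toℕ; fromℕ<; combine; remQuot)
open import Data.Fin.Patterns using (0F; 1F; 2F; 3F)
import Data.Fin.Permutation as Perm
open import Data.Fin.Permutation using (Permutation; Permutation′; permutation; _⟨$⟩ʳ_; _⟨$⟩ˡ_; inverseˡ; inverseʳ; transpose; _∘ₚ_; ↔⇒≡)
open import Data.Fin.Properties using (_≟_; any?; all?; pigeonhole; toℕ<n; toℕ-fromℕ<; toℕ-injective; remQuot-combine; injective⇒≤)
open import Data.List using (length; filter; tabulate)
open import Data.Nat using (ℕ; zero; suc; _+_; _*_; _∸_; _≤_; _<_; z≤n; s≤s; NonZero; >-nonZero)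
open import Data.Nat.DivMod using (_/_; _%_; m≡m%n+[m/n]*n; m%n<n)
open import Data.Nat.Induction using (<-wellFounded; Acc; acc)
open import Data.Nat.Properties using (+-mono-≤; +-mono-<-≤; +-mono-≤-<; ≤-refl; ≤-trans; ≤-reflexive; +-0-commutativeMonoid; <-cmp; m∸n+n≡m; m<n⇒0<n∸m; m∸n≤m; <⇒≤; +-comm; <-≤-trans; ≤-<-trans; <-irrefl; ≤-antisym; n<1+n; ≤-pred; +-cancelʳ-≤; 1+n≰n; m≤n+m; _≤?_; ≤-total; ≰⇒>; *-distribˡ-+; +-monoʳ-≤; +-cancelˡ-≤) renaming (_≟_ to _≟ℕ_)
open import Data.Nat.Tactic.RingSolver using (solve-∀)
open import Data.Product using (∃; _×_; _,_; proj₁; proj₂)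
open import Data.Sum using (_⊎_; inj₁; inj₂)
open import Data.Unit using (⊤; tt)
open import Data.Vec.Functional using (_∷_)
open import Function using (_∘_; id)
open import Function.Bundles using (_⇔_; mk⇔)
open import Function.Definitions using (Bijective; Injective; Surjective)
open import Relation.Binary.Construct.Closure.ReflexiveTransitive using (Star; ε; _◅_; gmap; _◅◅_)
open import Relation.Binary.Definitions using (tri<; tri≈; tri>)
open import Relation.Binary.PropositionalEquality using (_≡_; _≢_; _≗_; refl; sym; trans; cong; cong₂; subst; subst₂; module ≡-Reasoning)
open import Relation.Nullary using (¬_; Dec; yes; no; does)
open import Relation.Nullary.Decidable using (map′; _⊎-dec_; _×-dec_; _→-dec_; ¬?; toWitness; fromWitness; decidable-stable; dec-true; dec-false; isYes)
open import Algebra.Properties.CommutativeMonoid.Sum +-0-commutativeMonoid using (sum; sum-permute; sum-cong-≗; sum-replicate-zero; ∑-distrib-+)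

-- Sums and counts

⟦_⟧ : Bool → ℕ
⟦ true ⟧  = 1
⟦ false ⟧ = 0

sum-mono-≤ : ∀ {n} {f g : Fin n → ℕ} → (∀ i → f i ≤ g i) → sum f ≤ sum g
sum-mono-≤ {zero}  f≤g = z≤n
sum-mono-≤ {suc n} f≤g = +-mono-≤ (f≤g zero) (sum-mono-≤ (f≤g ∘ suc))

sum-mono-< : ∀ {n} {f g : Fin n → ℕ} → (∀ i → f i ≤ g i) → ∀ j → f j < g j → sum f < sum g
sum-mono-< f≤g zero    f<g = +-mono-<-≤ f<g (sum-mono-≤ (f≤g ∘ suc))
sum-mono-< f≤g (suc j) f<g = +-mono-≤-< (f≤g zero) (sum-mono-< (f≤g ∘ suc) j f<g)

length-filter-tabulate : ∀ {m n} (p : Fin n → Bool) (f : Fin m → Fin n) →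
  length (filter (λ u → T? (p u)) (tabulate f)) ≡ sum (λ i → ⟦ p (f i) ⟧)
length-filter-tabulate {zero}  p f = refl
length-filter-tabulate {suc m} p f with p (f zero)
... | true  = cong suc (length-filter-tabulate p (f ∘ suc))
... | false = length-filter-tabulate p (f ∘ suc)

#≡sum : ∀ {n} (p : Fin n → Bool) → #[ p ] ≡ sum (⟦_⟧ ∘ p)
#≡sum p = length-filter-tabulate p id

#-permute : ∀ {m n} (p : Fin n → Bool) (π : Permutation m n) → #[ p ] ≡ #[ (λ v → p (π ⟨$⟩ʳ v)) ]
#-permute p π = trans (#≡sum p) (trans (sum-permute (⟦_⟧ ∘ p) π) (sym (#≡sum (λ v → p (π ⟨$⟩ʳ v)))))

#-cong : ∀ {n} {p q : Fin n → Bool} → p ≗ q → #[ p ] ≡ #[ q ]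
#-cong {p = p} {q} p≗q = trans (#≡sum p) (trans (sum-cong-≗ (cong ⟦_⟧ ∘ p≗q)) (sym (#≡sum q)))

⟦⟧-mono : ∀ {p q} → (T p → T q) → ⟦ p ⟧ ≤ ⟦ q ⟧
⟦⟧-mono {false}         _ = z≤n
⟦⟧-mono {true}  {true}  _ = ≤-refl
⟦⟧-mono {true}  {false} i = ⊥-elim (i _)

⟦⟧-mono-< : ∀ {p q} → ¬ T p → T q → ⟦ p ⟧ < ⟦ q ⟧
⟦⟧-mono-< {false} {true}  _  _ = ≤-refl
⟦⟧-mono-< {true}          ¬p _ = ⊥-elim (¬p _)

⟦⟧-disjoint : ∀ {p q r} → ¬ (T p × T q) → (T p → T r) → (T q → T r) → ⟦ p ⟧ + ⟦ q ⟧ ≤ ⟦ r ⟧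
⟦⟧-disjoint {false}        _ _ j = ⟦⟧-mono j
⟦⟧-disjoint {true} {false} _ i _ = ⟦⟧-mono i
⟦⟧-disjoint {true} {true}  d _ _ = ⊥-elim (d _)

module _ {n : ℕ} where

  #-mono : {p q : Fin n → Bool} → (∀ v → T (p v) → T (q v)) → #[ p ] ≤ #[ q ]
  #-mono {p} {q} p⊆q rewrite #≡sum p | #≡sum q = sum-mono-≤ (⟦⟧-mono ∘ p⊆q)

  #-mono-< : {p q : Fin n → Bool} → (∀ v → T (p v) → T (q v)) →
             ∀ w → ¬ T (p w) → T (q w) → #[ p ] < #[ q ]
  #-mono-< {p} {q} p⊆q w ¬pw qw rewrite #≡sum p | #≡sum q =
    sum-mono-< (⟦⟧-mono ∘ p⊆q) w (⟦⟧-mono-< ¬pw qw)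

  #+#≡sum : (p q : Fin n → Bool) → #[ p ] + #[ q ] ≡ sum (λ v → ⟦ p v ⟧ + ⟦ q v ⟧)
  #+#≡sum p q rewrite #≡sum p | #≡sum q = sym (∑-distrib-+ (⟦_⟧ ∘ p) (⟦_⟧ ∘ q))

  #-disjoint : {p q r : Fin n → Bool} → (∀ v → ¬ (T (p v) × T (q v))) →
               (∀ v → T (p v) → T (r v)) → (∀ v → T (q v) → T (r v)) → #[ p ] + #[ q ] ≤ #[ r ]
  #-disjoint {p} {q} {r} d i j rewrite #+#≡sum p q | #≡sum r =
    sum-mono-≤ λ v → ⟦⟧-disjoint (d v) (i v) (j v)

  #-disjoint-< : {p q r : Fin n → Bool} → (∀ v → ¬ (T (p v) × T (q v))) →
                 (∀ v → T (p v) → T (r v)) → (∀ v → T (q v) → T (r v)) →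
                 ∀ w → ¬ T (p w) → ¬ T (q w) → T (r w) → #[ p ] + #[ q ] < #[ r ]
  #-disjoint-< {p} {q} {r} d i j w ¬pw ¬qw rw rewrite #+#≡sum p q | #≡sum r =
    sum-mono-< (λ v → ⟦⟧-disjoint (d v) (i v) (j v)) w (at-w ¬pw ¬qw rw)
    where
    at-w : ∀ {b c d} → ¬ T b → ¬ T c → T d → ⟦ b ⟧ + ⟦ c ⟧ < ⟦ d ⟧
    at-w {true}          ¬b _  _ = ⊥-elim (¬b _)
    at-w {false}         _  ¬c d = ⟦⟧-mono-< ¬c d

  #-nonempty : (p : Fin n → Bool) → 0 < #[ p ] → ∃ λ v → T (p v)
  #-nonempty p 0<#p with any? (λ v → T? (p v))
  ... | yes v = v
  ... | no ¬v = ⊥-elim (<-irrefl refl (<-≤-trans 0<#p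
                  (≤-trans (#-mono {p} {λ _ → false} (λ v pv → ¬v (v , pv))) (≤-reflexive none))))
    where
    none : #[ (λ (_ : Fin n) → false) ] ≡ 0
    none = trans (#≡sum {n} (λ _ → false)) (sum-replicate-zero n)

⟦⟧-overlap : ∀ {p q r t} → (T p → T r) → (T q → T r) → (T p → T q → T t) → ⟦ p ⟧ + ⟦ q ⟧ ≤ ⟦ r ⟧ + ⟦ t ⟧
⟦⟧-overlap {false} {false}         i j o = z≤n
⟦⟧-overlap {false} {true}  {true}  i j o = s≤s z≤n
⟦⟧-overlap {false} {true}  {false} i j o = ⊥-elim (j _)
⟦⟧-overlap {true}  {_}     {false} i j o = ⊥-elim (i _)
⟦⟧-overlap {true}  {false} {true}  i j o = s≤s z≤n
⟦⟧-overlap {true}  {true}  {true}  {true}  i j o = ≤-refl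
⟦⟧-overlap {true}  {true}  {true}  {false} i j o = ⊥-elim (o _ _)

module _ {n : ℕ} {p q r t : Fin n → Bool} (p⊆r : ∀ v → T (p v) → T (r v))
         (q⊆r : ∀ v → T (q v) → T (r v)) (p∩q⊆t : ∀ v → T (p v) → T (q v) → T (t v)) where

  -- A vertex counted twice on the left lies in `p` and in `q`, and `t` pays for its second count.
  #-overlap : #[ p ] + #[ q ] ≤ #[ r ] + #[ t ]
  #-overlap rewrite #+#≡sum p q | #+#≡sum r t = sum-mono-≤ λ v → ⟦⟧-overlap (p⊆r v) (q⊆r v) (p∩q⊆t v)

  #-overlap-< : ∀ w → ⟦ p w ⟧ + ⟦ q w ⟧ < ⟦ r w ⟧ + ⟦ t w ⟧ → #[ p ] + #[ q ] < #[ r ] + #[ t ]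
  #-overlap-< w lt rewrite #+#≡sum p q | #+#≡sum r t =
    sum-mono-< (λ v → ⟦⟧-overlap (p⊆r v) (q⊆r v) (p∩q⊆t v)) w lt

#-cover : ∀ {n} {r p q : Fin n → Bool} → (∀ v → T (r v) → T (p v) ⊎ T (q v)) → #[ r ] ≤ #[ p ] + #[ q ]
#-cover {r = r} {p} {q} cover rewrite #+#≡sum p q | #≡sum r = sum-mono-≤ λ v → pointwise (cover v)
  where
  pointwise : ∀ {b c d} → (T b → T c ⊎ T d) → ⟦ b ⟧ ≤ ⟦ c ⟧ + ⟦ d ⟧
  pointwise {false}                _ = z≤n
  pointwise {true} {true}          _ = s≤s z≤n
  pointwise {true} {false} {true}  _ = ≤-refl
  pointwise {true} {false} {false} i with i _
  ... | inj₁ ()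
  ... | inj₂ ()

infixr 5 _⊕_
_⊕_ : ∀ {i j k l} → i ≤ j → k ≤ l → i + k ≤ j + l
_⊕_ = +-mono-≤

-- Closes the numerical contradictions: inequalities are added up with `_⊕_`, and a ring identity
-- shows that the left total exceeds the right one by `suc k`.
overflow : ∀ {l r} k → l ≤ r → l ≡ suc (k + r) → ⊥
overflow {r = r} k l≤r refl = 1+n≰n (≤-trans l≤r (m≤n+m r k))

T-ext : ∀ {b c} → (T b → T c) → (T c → T b) → b ≡ c
T-ext {true}  {true}  _ _ = refl
T-ext {true}  {false} i _ = ⊥-elim (i _)
T-ext {false} {true}  _ j = ⊥-elim (j _)
T-ext {false} {false} _ _ = refl

⟦⟧*-mono-≤ : ∀ {b i j} → (T b → i ≤ j) → ⟦ b ⟧ * i ≤ ⟦ b ⟧ * j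
⟦⟧*-mono-≤ {true}  i≤j = i≤j _ ⊕ z≤n
⟦⟧*-mono-≤ {false} _   = z≤n

⟦⟧*-mono-< : ∀ {b i j} → T b → i < j → ⟦ b ⟧ * i < ⟦ b ⟧ * j
⟦⟧*-mono-< {true} _ i<j = i<j ⊕ z≤n

⟦⟧-overlap-<ˡ : ∀ {p q r t} → ¬ T p → T r → T t → ⟦ p ⟧ + ⟦ q ⟧ < ⟦ r ⟧ + ⟦ t ⟧
⟦⟧-overlap-<ˡ {true}                         ¬p _ _ = ⊥-elim (¬p _)
⟦⟧-overlap-<ˡ {false} {true}  {true} {true}  _  _ _ = ≤-refl
⟦⟧-overlap-<ˡ {false} {false} {true} {true}  _  _ _ = s≤s z≤n

⟦⟧-overlap-< : ∀ {p q r t} → ¬ T p → ¬ T q → T r → ⟦ p ⟧ + ⟦ q ⟧ < ⟦ r ⟧ + ⟦ t ⟧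
⟦⟧-overlap-< {true}                 ¬p _  _ = ⊥-elim (¬p _)
⟦⟧-overlap-< {false} {true}         _  ¬q _ = ⊥-elim (¬q _)
⟦⟧-overlap-< {false} {false} {true} _  _  _ = s≤s z≤n

⟨_⟩ : ∀ {n} → Fin n → Fin n → Bool
⟨ w ⟩ v = does (v ≟ w)

#-singleton : ∀ {n} (w : Fin n) → #[ ⟨ w ⟩ ] ≡ 1
#-singleton w = trans (#≡sum ⟨ w ⟩) (go w)
  where
  go : ∀ {n} (w : Fin n) → sum (λ v → ⟦ ⟨ w ⟩ v ⟧) ≡ 1
  go {suc n} zero    = cong suc (sum-replicate-zero n)
  go {suc n} (suc w) = go w

∈⟨⟩ : ∀ {n} {v w : Fin n} → v ≡ w → T (⟨ w ⟩ v)
∈⟨⟩ {v = v} refl rewrite dec-true (v ≟ v) refl = _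

⟨⟩⇒≡ : ∀ {n} {v w : Fin n} → T (⟨ w ⟩ v) → v ≡ w
⟨⟩⇒≡ {v = v} {w} t with v ≟ w
... | yes eq = eq

-- Search over functions between finite sets

-- Tries all values at `zero` and recurses; `resp` stands in for function extensionality. This makes
-- `Hamiltonian` and `Isomorphic` decidable, so both may be proved by contradiction.
any-function? : ∀ {n} m {P : (Fin m → Fin n) → Set} → (∀ {f g} → f ≗ g → P f → P g) →
                (∀ f → Dec (P f)) → Dec (∃ P)
any-function? zero    resp P? = map′ (λ p → _ , p) (λ (f , p) → resp (λ ()) p) (P? λ ())
any-function? (suc m) {P} resp P? =
  map′ (λ (x , f , p) → x ∷ f , p)
       (λ (f , p) → f zero , f ∘ suc , resp (λ { zero → refl ; (suc i) → refl }) p)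
       (any? λ x → any-function? m {λ f → P (x ∷ f)} (λ f≗g → resp λ { zero → refl ; (suc i) → f≗g i })
                     (λ f → P? (x ∷ f)))

bijective-resp : ∀ {m n} {f g : Fin m → Fin n} → f ≗ g → Bijective _≡_ _≡_ f → Bijective _≡_ _≡_ g
bijective-resp f≗g (inj , surj) =
  (λ {x} {y} gx≡gy → inj (trans (f≗g x) (trans gx≡gy (sym (f≗g y))))) ,
  λ y → proj₁ (surj y) , λ z≡x → trans (sym (f≗g _)) (proj₂ (surj y) z≡x)

bijective? : ∀ {m n} (f : Fin m → Fin n) → Dec (Bijective _≡_ _≡_ f)
bijective? f =
  map′ (λ inj {x} {y} → inj x y) (λ inj x y → inj) (all? λ x → all? λ y → (f x ≟ f y) →-dec (x ≟ y))
  ×-dec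
  map′ (λ surj y → proj₁ (surj y) , λ { refl → proj₂ (surj y) })
       (λ surj y → proj₁ (surj y) , proj₂ (surj y) refl)
       (all? λ y → any? λ x → f x ≟ y)

-- Permutations

apply-transposeˡ : ∀ {n} (i j : Fin n) → transpose i j ⟨$⟩ʳ i ≡ j
apply-transposeˡ i j rewrite dec-true (i ≟ i) refl = refl

apply-transposeʳ : ∀ {n} (i j : Fin n) → transpose i j ⟨$⟩ʳ j ≡ i
apply-transposeʳ i j with j ≟ i
... | yes j≡i = j≡i
... | no  _ rewrite dec-true (j ≟ j) refl = refl

apply-transpose-else : ∀ {n} (i j : Fin n) {k} → k ≢ i → k ≢ j → transpose i j ⟨$⟩ʳ k ≡ k
apply-transpose-else i j {k} k≢i k≢j rewrite dec-false (k ≟ i) k≢i | dec-false (k ≟ j) k≢j = refl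

-- Since the goal is ⊥, a permutation maximal for inclusion of the set G σ may be assumed.
assume-maximal : ∀ {n k} (Inv : Permutation′ n → Set) (G : Permutation′ n → Fin k → Bool) →
  (∀ σ → Inv σ →
     (∀ τ → Inv τ → (∀ i → T (G σ i) → T (G τ i)) → ∀ i → T (G τ i) → T (G σ i)) → ⊥) →
  ∀ σ → Inv σ → ⊥
assume-maximal {n} {k} Inv G step σ = go σ (<-wellFounded (#[ (λ i → not (G σ i)) ]))
  where
  T-not : ∀ {b} → T (not b) → ¬ T b
  T-not {true} ()
  ¬T⇒T-not : ∀ {b} → ¬ T b → T (not b)
  ¬T⇒T-not {true}  ¬b = ¬b _
  ¬T⇒T-not {false} _  = _
  go : ∀ σ → Acc _<_ (#[ (λ i → not (G σ i)) ]) → Inv σ → ⊥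
  go σ (acc rec) inv = step σ inv maximal
    where
    maximal : ∀ τ → Inv τ → (∀ i → T (G σ i) → T (G τ i)) → ∀ i → T (G τ i) → T (G σ i)
    maximal τ invτ σ⊆τ i τi with T? (G σ i)
    ... | yes σi = σi
    -- A strictly larger `G τ` has a strictly smaller complement, whose size is the measure of the
    -- recursion.
    ... | no ¬σi = ⊥-elim (go τ (rec (#-mono-< {k} {λ i → not (G τ i)} {λ i → not (G σ i)}
                     (λ j ¬τj → ¬T⇒T-not (T-not ¬τj ∘ σ⊆τ j)) i
                     (λ ¬τi → T-not ¬τi τi) (¬T⇒T-not ¬σi))) invτ)

-- `_∘ₚ_` applies its left factor first, so `x` and `z` exchange their images.
swap : ∀ {n} → Permutation′ n → Fin n → Fin n → Permutation′ n
swap σ x z = transpose x z ∘ₚ σ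

module _ {n : ℕ} (σ : Permutation′ n) (x z : Fin n) where

  swap-ˡ : swap σ x z ⟨$⟩ʳ x ≡ σ ⟨$⟩ʳ z
  swap-ˡ = cong (σ ⟨$⟩ʳ_) (apply-transposeˡ x z)

  swap-ʳ : swap σ x z ⟨$⟩ʳ z ≡ σ ⟨$⟩ʳ x
  swap-ʳ = cong (σ ⟨$⟩ʳ_) (apply-transposeʳ x z)

  swap-else : ∀ {u} → u ≢ x → u ≢ z → swap σ x z ⟨$⟩ʳ u ≡ σ ⟨$⟩ʳ u
  swap-else u≢x u≢z = cong (σ ⟨$⟩ʳ_) (apply-transpose-else x z u≢x u≢z)

  swap-elim : ∀ {ℓ} (P : Fin n → Fin n → Set ℓ) → P x (σ ⟨$⟩ʳ z) → P z (σ ⟨$⟩ʳ x) →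
              (∀ u → u ≢ x → u ≢ z → P u (σ ⟨$⟩ʳ u)) → ∀ u → P u (swap σ x z ⟨$⟩ʳ u)
  swap-elim P px pz pu u = go (u ≟ x) (u ≟ z)
    where
    go : Dec (u ≡ x) → Dec (u ≡ z) → P u (swap σ x z ⟨$⟩ʳ u)
    go (yes refl) _          = subst (P x) (sym swap-ˡ) px
    go (no  _)    (yes refl) = subst (P z) (sym swap-ʳ) pz
    go (no  u≢x)  (no  u≢z)  = subst (P u) (sym (swap-else u≢x u≢z)) (pu u u≢x u≢z)

perm-injective : ∀ {m n} (π : Permutation m n) {i j} → π ⟨$⟩ʳ i ≡ π ⟨$⟩ʳ j → i ≡ j
perm-injective π eq = trans (sym (inverseˡ π)) (trans (cong (π ⟨$⟩ˡ_) eq) (inverseˡ π))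

-- Orbits

iter : ∀ {n} → Permutation′ n → ℕ → Fin n → Fin n
iter σ zero    u = u
iter σ (suc k) u = iter σ k (σ ⟨$⟩ʳ u)

Reach : ∀ {n} → Permutation′ n → Fin n → Fin n → Set
Reach σ u v = ∃ λ k → iter σ k u ≡ v

module _ {n : ℕ} (σ : Permutation′ n) where

  iter-+ : ∀ j k u → iter σ (j + k) u ≡ iter σ k (iter σ j u)
  iter-+ zero    k u = refl
  iter-+ (suc j) k u = iter-+ j k (σ ⟨$⟩ʳ u)

  iter-suc : ∀ k u → iter σ (suc k) u ≡ σ ⟨$⟩ʳ iter σ k u
  iter-suc zero    u = refl
  iter-suc (suc k) u = iter-suc k (σ ⟨$⟩ʳ u)

  iter-injective : ∀ k {u v} → iter σ k u ≡ iter σ k v → u ≡ v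
  iter-injective zero    eq = eq
  iter-injective (suc k) eq = perm-injective σ (iter-injective k eq)

  iter-*-period : ∀ {p u} → iter σ p u ≡ u → ∀ q → iter σ (q * p) u ≡ u
  iter-*-period         per zero    = refl
  iter-*-period {p} {u} per (suc q) =
    trans (iter-+ p (q * p) u) (trans (cong (iter σ (q * p)) per) (iter-*-period per q))

  period-from-collision : ∀ u {i j} → i < j → iter σ i u ≡ iter σ j u →
                          0 < j ∸ i × iter σ (j ∸ i) u ≡ u
  period-from-collision u {i} {j} i<j eq = m<n⇒0<n∸m i<j , iter-injective i (sym (begin
    iter σ i u                    ≡⟨ eq ⟩
    iter σ j u                    ≡⟨ cong (λ k → iter σ k u) (m∸n+n≡m (<⇒≤ i<j)) ⟨
    iter σ (j ∸ i + i) u          ≡⟨ iter-+ (j ∸ i) i u ⟩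
    iter σ i (iter σ (j ∸ i) u)   ∎))
    where open ≡-Reasoning

  -- Among the first `suc n` iterates two coincide, and injectivity moves the collision back to `u`.
  period : ∀ u → ∃ λ p → 0 < p × p ≤ n × iter σ p u ≡ u
  period u with i , j , i<j , eq ← pigeonhole (n<1+n n) (λ i → iter σ (toℕ i) u)
    with 0<p , per ← period-from-collision u i<j eq
    = toℕ j ∸ toℕ i , 0<p , ≤-trans (m∸n≤m (toℕ j) (toℕ i)) (≤-pred (toℕ<n j)) , per

  reach-within-period : ∀ {p u v} → 0 < p → iter σ p u ≡ u → Reach σ u v →
                        ∃ λ r → r < p × iter σ r u ≡ v
  reach-within-period {p} {u} {v} 0<p per (k , eq) = k % p , m%n<n k p , (begin
    iter σ (k % p) u                            ≡⟨ cong (iter σ (k % p)) (iter-*-period per (k / p)) ⟨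
    iter σ (k % p) (iter σ (k / p * p) u)       ≡⟨ iter-+ (k / p * p) (k % p) u ⟨
    iter σ (k / p * p + k % p) u                ≡⟨ cong (λ i → iter σ i u) (+-comm (k / p * p) (k % p)) ⟩
    iter σ (k % p + k / p * p) u                ≡⟨ cong (λ i → iter σ i u) (m≡m%n+[m/n]*n k p) ⟨
    iter σ k u                                  ≡⟨ eq ⟩
    v                                           ∎)
    where
    open ≡-Reasoning
    instance
      p≢0 : NonZero p
      p≢0 = >-nonZero 0<p

  reach-refl : ∀ {u} → Reach σ u u
  reach-refl = 0 , refl

  reach-trans : ∀ {u v w} → Reach σ u v → Reach σ v w → Reach σ u w
  reach-trans {u} (j , refl) (k , refl) = j + k , iter-+ j k u

  reach-step : ∀ u → Reach σ u (σ ⟨$⟩ʳ u)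
  reach-step u = 1 , refl

  -- The rest of the period leads from `v` back to `u`; so forward iterates alone give the orbit
  -- relation.
  reach-sym : ∀ {u v} → Reach σ u v → Reach σ v u
  reach-sym {u} {v} u~v with p , 0<p , _ , per ← period u
    with r , r<p , refl ← reach-within-period 0<p per u~v
    = p ∸ r , trans (sym (iter-+ r (p ∸ r) u)) (trans (cong (λ i → iter σ i u) (trans (+-comm r (p ∸ r)) (m∸n+n≡m (<⇒≤ r<p)))) per)

  reach-pred : ∀ u → Reach σ u (σ ⟨$⟩ˡ u)
  reach-pred u = reach-sym (1 , inverseʳ σ)

  reach? : ∀ u v → Dec (Reach σ u v)
  reach? u v = map′ (λ (i , eq) → toℕ i , eq) bounded (any? λ i → iter σ (toℕ i) u ≟ v)
    where
    bounded : Reach σ u v → ∃ λ (i : Fin n) → iter σ (toℕ i) u ≡ v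
    bounded u~v with p , 0<p , p≤n , per ← period u
      with r , r<p , eq ← reach-within-period 0<p per u~v
      = fromℕ< (<-≤-trans r<p p≤n) , trans (cong (λ i → iter σ i u) (toℕ-fromℕ< (<-≤-trans r<p p≤n))) eq

reach-⊆ : ∀ {n} (σ : Permutation′ n) {τ : Permutation′ n} → (∀ u → Reach τ u (σ ⟨$⟩ʳ u)) →
          ∀ {u v} → Reach σ u v → Reach τ u v
reach-⊆ σ {τ} step     (zero  , refl) = reach-refl τ
reach-⊆ σ {τ} step {u} (suc k , eq)   = reach-trans τ (step u) (reach-⊆ σ {τ} step (k , eq))

module _ {n : ℕ} (σ : Permutation′ n) {x z : Fin n} (x≁z : ¬ Reach σ x z) where

  private
    τ = swap σ x z

    -- A walk of σ that starts off the orbit of w only meets {v, w} at v, where it may be stopped.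
    walk : ∀ {v w} → (∀ {u} → u ≢ v → u ≢ w → τ ⟨$⟩ʳ u ≡ σ ⟨$⟩ʳ u) →
           ∀ k {u} → iter σ k u ≡ v → ¬ Reach σ u w → Reach τ u v
    walk         agree zero    refl u≁w = reach-refl τ
    walk {v} {w} agree (suc k) {u} eq u≁w with u ≟ v
    ... | yes refl = reach-refl τ
    ... | no  u≢v  = reach-trans τ (1 , agree u≢v λ { refl → u≁w (reach-refl σ) })
                       (walk agree k eq λ (i , σu~w) → u≁w (suc i , σu~w))

    x-closes : Reach τ (σ ⟨$⟩ʳ x) x
    x-closes with k , eq ← reach-sym σ (reach-step σ x) =
      walk (swap-else σ x z) k eq λ (i , r) → x≁z (suc i , r)

    z-closes : Reach τ (σ ⟨$⟩ʳ z) z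
    z-closes with k , eq ← reach-sym σ (reach-step σ z) =
      walk (λ u≢z u≢x → swap-else σ x z u≢x u≢z) k eq λ (i , r) → x≁z (reach-sym σ (suc i , r))

  -- After the exchange `x` enters the old cycle of `z` at `σ z` and follows it up to `z`.
  fuse-joins : Reach τ x z
  fuse-joins = reach-trans τ (1 , swap-ˡ σ x z) z-closes

  fuse-⊆ : ∀ {u v} → Reach σ u v → Reach τ u v
  fuse-⊆ = reach-⊆ σ {τ} step
    where
    step : ∀ u → Reach τ u (σ ⟨$⟩ʳ u)
    step u with u ≟ x
    ... | yes refl = reach-sym τ x-closes
    ... | no  u≢x with u ≟ z
    ...   | yes refl = reach-sym τ z-closes
    ...   | no  u≢z  = 1 , swap-else σ x z u≢x u≢z

-- Hamiltonian cycles

IsFactor : ∀ {n} → Digraph n → Permutation′ n → Set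
IsFactor D σ = ∀ u → T (arc D u (σ ⟨$⟩ʳ u))

-- The iterates of `u` enumerate the vertices once its period is known to be `n`: it is at most `n`
-- by pigeonhole, and at least `n` because every vertex is an iterate of index below the period.
single-orbit⇒hamiltonian : ∀ {n} (D : Digraph n) (σ : Permutation′ n) → IsFactor D σ →
  ∀ u → (∀ v → Reach σ u v) → Hamiltonian D
single-orbit⇒hamiltonian {n} D σ factor u all~u = c , (injective , surjective) , arcs
  where
  c : Fin n → Fin n
  c i = iter σ (toℕ i) u

  n≤period : ∀ {p} → 0 < p → iter σ p u ≡ u → n ≤ p
  n≤period {p} 0<p per = injective⇒≤ {f = index} index-injective
    where
    within : ∀ v → ∃ λ r → r < p × iter σ r u ≡ v
    within v = reach-within-period σ 0<p per (all~u v)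
    index : Fin n → Fin p
    index v = fromℕ< (proj₁ (proj₂ (within v)))
    iter-index : ∀ v → iter σ (toℕ (index v)) u ≡ v
    iter-index v = trans (cong (λ i → iter σ i u) (toℕ-fromℕ< (proj₁ (proj₂ (within v))))) (proj₂ (proj₂ (within v)))
    index-injective : Injective _≡_ _≡_ index
    index-injective {v} {w} eq = trans (sym (iter-index v)) (trans (cong (λ i → iter σ (toℕ i) u) eq) (iter-index w))

  period-n : iter σ n u ≡ u
  period-n with p , 0<p , p≤n , per ← period σ u = subst (λ k → iter σ k u ≡ u) (≤-antisym p≤n (n≤period 0<p per)) per

  no-collision : ∀ {i j : Fin n} → toℕ i < toℕ j → c i ≢ c j
  no-collision {i} {j} i<j eq with 0<p , per ← period-from-collision σ u i<j eq =
    <-irrefl refl (≤-<-trans (≤-trans (n≤period 0<p per) (m∸n≤m (toℕ j) (toℕ i))) (toℕ<n j))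

  injective : Injective _≡_ _≡_ c
  injective {i} {j} eq with <-cmp (toℕ i) (toℕ j)
  ... | tri< i<j _ _ = ⊥-elim (no-collision i<j eq)
  ... | tri≈ _ i≡j _ = toℕ-injective i≡j
  ... | tri> _ _ j<i = ⊥-elim (no-collision j<i (sym eq))

  0<n : 0 < n
  0<n with p , 0<p , p≤n , _ ← period σ u = <-≤-trans 0<p p≤n

  surjective : Surjective _≡_ _≡_ c
  surjective v with r , r<n , eq ← reach-within-period σ 0<n period-n (all~u v) =
    fromℕ< r<n , λ { refl → trans (cong (λ i → iter σ i u) (toℕ-fromℕ< r<n)) eq }

  arcs : ∀ i j → (suc (toℕ i) ≡ toℕ j ⊎ (suc (toℕ i) ≡ n × toℕ j ≡ 0)) → T (arc D (c i) (c j))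
  arcs i j next = subst (λ v → T (arc D (c i) v)) (trans (sym (iter-suc σ (toℕ i) u)) (next-iter next)) (factor (c i))
    where
    next-iter : (suc (toℕ i) ≡ toℕ j ⊎ (suc (toℕ i) ≡ n × toℕ j ≡ 0)) → iter σ (suc (toℕ i)) u ≡ c j
    next-iter (inj₁ eq)        = cong (λ k → iter σ k u) eq
    next-iter (inj₂ (eq , j≡0)) = trans (cong (λ k → iter σ k u) eq) (trans period-n (cong (λ k → iter σ k u) (sym j≡0)))

hamiltonian? : ∀ {n} (D : Digraph n) → Dec (Hamiltonian D)
hamiltonian? {n} D = any-function? n
  (λ f≗g (bij , arcs) → bijective-resp f≗g bij ,
     λ i j next → subst₂ (λ u v → T (arc D u v)) (f≗g i) (f≗g j) (arcs i j next))
  (λ c → bijective? c ×-dec all? λ i → all? λ j →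
     ((suc (toℕ i) ≟ℕ toℕ j) ⊎-dec ((suc (toℕ i) ≟ℕ n) ×-dec (toℕ j ≟ℕ 0))) →-dec T? (arc D (c i) (c j)))

-- Sides and degree bounds in balanced bipartite digraphs

≢-≢⇒≡ : ∀ {b c d : Bool} → b ≢ c → c ≢ d → b ≡ d
≢-≢⇒≡ b≢c c≢d = trans (¬-not b≢c) (sym (¬-not (c≢d ∘ sym)))

T-differ : ∀ {b c} → b ≢ c → T (differ b c)
T-differ {false} {false} b≢c = b≢c refl
T-differ {false} {true}  _   = _
T-differ {true}  {false} _   = _
T-differ {true}  {true}  b≢c = b≢c refl

differ⇒≢ : ∀ {b c} → T (differ b c) → b ≢ c
differ⇒≢ {true}  {true}  () refl
differ⇒≢ {false} {false} () refl

T-not-differ : ∀ {b c} → b ≡ c → T (not (differ b c))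
T-not-differ {true}  refl = _
T-not-differ {false} refl = _

not-differ⇒≡ : ∀ {b c} → T (not (differ b c)) → b ≡ c
not-differ⇒≡ {true}  {true}  _ = refl
not-differ⇒≡ {false} {false} _ = refl

-- This is the arc by which the path first leaves `P`. With an orbit of a factor as `P`, strong
-- connectivity yields arcs between different orbits.
star-crosses : ∀ {A : Set} {R : A → A → Set} {P : A → Set} → (∀ x → Dec (P x)) → ∀ {u v} →
               Star R u v → P u → ¬ P v → ∃ λ x → ∃ λ y → P x × ¬ P y × R x y
star-crosses P? ε               Pu ¬Pv = ⊥-elim (¬Pv Pu)
star-crosses P? (_◅_ {j = w} r rs) Pu ¬Pv with P? w
... | yes Pw = star-crosses P? rs Pw ¬Pv
... | no ¬Pw = _ , _ , Pu , ¬Pw , r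

module Bipartite {n : ℕ} (D : Digraph n) (side : Fin n → Bool) (a : ℕ)
                 (bal : BalancedBipartite D side a) where

  infix 4 _⟶_
  _⟶_ : Fin n → Fin n → Set
  u ⟶ v = T (arc D u v)

  _⟶?_ : ∀ u v → Dec (u ⟶ v)
  u ⟶? v = T? (arc D u v)

  opp same : Fin n → Fin n → Bool
  opp u v  = differ (side u) (side v)
  same u v = not (opp u v)

  crosses : ∀ {u v} → u ⟶ v → side u ≢ side v
  crosses {u} {v} = proj₁ bal u v

  #opp : ∀ u → #[ opp u ] ≡ a
  #opp u with side u
  ... | true  = proj₂ (proj₂ bal)
  ... | false = proj₁ (proj₂ bal)

  #same : ∀ u → #[ same u ] ≡ a
  #same u with side u
  ... | true  = trans (#-cong (λ v → not-involutive (side v))) (proj₁ (proj₂ bal))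
  ... | false = proj₂ (proj₂ bal)

  d⁺≤a : ∀ x → d⁺ D x ≤ a
  d⁺≤a x = subst (d⁺ D x ≤_) (#opp x) (#-mono {p = arc D x} {opp x} λ v → T-differ ∘ crosses)

  d⁻≤a : ∀ x → d⁻ D x ≤ a
  d⁻≤a x = subst (d⁻ D x ≤_) (#opp x) (#-mono {p = λ v → arc D v x} {opp x} λ v e → T-differ (crosses e ∘ sym))

  d⁺<a : ∀ {x v} → side x ≢ side v → ¬ x ⟶ v → d⁺ D x < a
  d⁺<a {x} {v} x≢v ¬e = subst (d⁺ D x <_) (#opp x)
    (#-mono-< {p = arc D x} {opp x} (λ v → T-differ ∘ crosses) v ¬e (T-differ x≢v))

  d⁻<a : ∀ {x v} → side x ≢ side v → ¬ v ⟶ x → d⁻ D x < a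
  d⁻<a {x} {v} x≢v ¬e = subst (d⁻ D x <_) (#opp x)
    (#-mono-< {p = λ v → arc D v x} {opp x} (λ v e → T-differ (crosses e ∘ sym)) v ¬e (T-differ x≢v))

  d⁺≤1 : ∀ {x w} → (∀ {v} → x ⟶ v → v ≡ w) → d⁺ D x ≤ 1
  d⁺≤1 {x} {w} unique = subst (d⁺ D x ≤_) (#-singleton w)
    (#-mono {p = arc D x} {⟨ w ⟩} λ v e → ∈⟨⟩ (unique e))

  d⁻≤1 : ∀ {x w} → (∀ {v} → v ⟶ x → v ≡ w) → d⁻ D x ≤ 1
  d⁻≤1 {x} {w} unique = subst (d⁻ D x ≤_) (#-singleton w)
    (#-mono {p = λ v → arc D v x} {⟨ w ⟩} λ v e → ∈⟨⟩ (unique e))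

  module _ {x y : Fin n} (x≡y : side x ≡ side y) where

    private
      x⊆ : ∀ v → x ⟶ v → T (opp x v)
      x⊆ v = T-differ ∘ crosses
      y⊆ : ∀ v → y ⟶ v → T (opp x v)
      y⊆ v e = T-differ (crosses e ∘ trans (sym x≡y))
      x⊇ : ∀ v → v ⟶ x → T (opp x v)
      x⊇ v e = T-differ (crosses e ∘ sym)
      y⊇ : ∀ v → v ⟶ y → T (opp x v)
      y⊇ v e = T-differ (λ eq → crosses e (trans (sym eq) x≡y))

    d⁺-disjoint : (∀ v → ¬ (x ⟶ v × y ⟶ v)) → d⁺ D x + d⁺ D y ≤ a
    d⁺-disjoint disj = subst (d⁺ D x + d⁺ D y ≤_) (#opp x) (#-disjoint {p = arc D x} {arc D y} {opp x} disj x⊆ y⊆)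

    d⁻-disjoint : (∀ v → ¬ (v ⟶ x × v ⟶ y)) → d⁻ D x + d⁻ D y ≤ a
    d⁻-disjoint disj = subst (d⁻ D x + d⁻ D y ≤_) (#opp x)
      (#-disjoint {p = λ v → arc D v x} {λ v → arc D v y} {opp x} disj x⊇ y⊇)

    d⁺-disjoint-< : (∀ v → ¬ (x ⟶ v × y ⟶ v)) → ∀ w → side x ≢ side w → ¬ x ⟶ w → ¬ y ⟶ w →
                    d⁺ D x + d⁺ D y < a
    d⁺-disjoint-< disj w x≢w ¬xw ¬yw = subst (d⁺ D x + d⁺ D y <_) (#opp x)
      (#-disjoint-< {p = arc D x} {arc D y} {opp x} disj x⊆ y⊆ w ¬xw ¬yw (T-differ x≢w))

  deg≤2a : ∀ x → deg D x ≤ a + a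
  deg≤2a x = d⁺≤a x ⊕ d⁻≤a x

  Swapping : Permutation′ n → Set
  Swapping σ = ∀ u → side u ≢ side (σ ⟨$⟩ʳ u)

  module _ {σ : Permutation′ n} (swapping : Swapping σ) where

    d⁺-σ : ∀ x → d⁺ D x ≡ #[ (λ v → arc D x (σ ⟨$⟩ʳ v)) ]
    d⁺-σ x = #-permute (arc D x) σ

    out-σ-same : ∀ {z v} → z ⟶ σ ⟨$⟩ʳ v → side z ≡ side v
    out-σ-same {z} {v} e = ≢-≢⇒≡ (crosses e) (swapping v ∘ sym)

    module _ {z y : Fin n} (z≢y : side z ≢ side y)
             (disj : ∀ v → ¬ (z ⟶ σ ⟨$⟩ʳ v × v ⟶ y)) where

      private
        z⊆ : ∀ v → z ⟶ σ ⟨$⟩ʳ v → T (same z v)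
        z⊆ v e = T-not-differ (out-σ-same e)
        y⊆ : ∀ v → v ⟶ y → T (same z v)
        y⊆ v e = T-not-differ (≢-≢⇒≡ z≢y (crosses e ∘ sym))

      -- Pulled back along `σ`, the out-neighbours of `z` lie on the side of `z`, as do the
      -- in-neighbours of `y`; two disjoint sets there that both miss `w` have fewer than `a`
      -- elements together.
      d⁺+d⁻-disjoint-< : ∀ w → side z ≡ side w → ¬ z ⟶ σ ⟨$⟩ʳ w → ¬ w ⟶ y → d⁺ D z + d⁻ D y < a
      d⁺+d⁻-disjoint-< w z≡w ¬zw ¬wy rewrite d⁺-σ z = subst (_ <_) (#same z)
        (#-disjoint-< {p = λ v → arc D z (σ ⟨$⟩ʳ v)} {λ v → arc D v y} {same z} disj z⊆ y⊆
           w ¬zw ¬wy (T-not-differ z≡w))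

  -- Existence of a cycle factor

  -- Take as many `u` as possible sent to the other side. If `u` stays on its side, no `v` opposite
  -- `u` has its image opposite `u`, since exchanging the images of `u` and `v` would help. So `u`
  -- and the `a` vertices opposite it are all sent into the side of `u`, which has only `a`
  -- vertices.
  swapping-exists : (∀ σ → Swapping σ → ⊥) → ⊥
  swapping-exists ¬swapping = assume-maximal (λ _ → ⊤) G contradict Perm.id tt
    where
    G : Permutation′ n → Fin n → Bool
    G σ u = opp u (σ ⟨$⟩ʳ u)

    contradict : ∀ σ → ⊤ →
      (∀ τ → ⊤ → (∀ i → T (G σ i) → T (G τ i)) → ∀ i → T (G τ i) → T (G σ i)) → ⊥
    contradict σ _ maximal = ¬swapping σ swapping
      where
      swapping : Swapping σ
      swapping u u≡σu with any? (λ v → T? (opp u v) ×-dec ¬? (T? (same u (σ ⟨$⟩ʳ v))))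
      ... | yes (v , u≢v , u≢σv) = differ⇒≢ {side u} (maximal (swap σ u v) tt
              (swap-elim σ u v (λ i j → T (G σ i) → T (opp i j))
                 (λ _ → T-differ λ eq → u≢σv (T-not-differ {side u} eq))
                 (λ _ → T-differ λ eq → differ⇒≢ u≢v (trans u≡σu (sym eq)))
                 (λ _ _ _ e → e))
              u (T-differ {side u} λ eq → u≢σv (T-not-differ {side u} (trans eq (cong side (swap-ˡ σ u v)))))) u≡σu
      ... | no ¬v = <-irrefl refl (subst₂ _<_ (#opp u) (trans (sym (#-permute (same u) σ)) (#same u))
              (#-mono-< {p = opp u} {λ v → same u (σ ⟨$⟩ʳ v)}
                 (λ v u≢v → decidable-stable (T? (same u (σ ⟨$⟩ʳ v))) λ ¬s → ¬v (v , u≢v , ¬s))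
                 u (λ u≢u → differ⇒≢ {side u} u≢u refl) (T-not-differ u≡σu)))

module Dense {n : ℕ} (D : Digraph n) (side : Fin n → Bool) (a : ℕ)
             (bal : BalancedBipartite D side a) (0<a : 0 < a)
             (strong : StronglyConnected D) (degrees : DegreeCondition D a) where

  open Bipartite D side a bal public

  opposite-vertex : ∀ u → ∃ λ v → side u ≢ side v
  opposite-vertex u with v , u≢v ← #-nonempty (opp u) (subst (0 <_) (sym (#opp u)) 0<a) = v , differ⇒≢ u≢v

  out-neighbour : ∀ u → ∃ λ v → u ⟶ v
  out-neighbour u with w , u≢w ← opposite-vertex u
    with _ , v , refl , _ , e ← star-crosses (_≟ u) (strong u w) refl (λ eq → u≢w (cong side (sym eq)))
    = v , e

  in-neighbour : ∀ u → ∃ λ v → v ⟶ u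
  in-neighbour u with w , u≢w ← opposite-vertex u
    with v , y , _ , ¬y≢u , e ← star-crosses (λ v → ¬? (v ≟ u)) (strong w u) (λ eq → u≢w (cong side (sym eq))) (λ u≢u → u≢u refl)
    with refl ← decidable-stable (y ≟ u) ¬y≢u
    = v , e

  private
    no-bad : ∀ a p q r s t u w k →
      (3 * a + (q + (s + suc (r + t)))) + (3 * a + (u + (w + suc (p + k)))) ≡
      suc (1 + (((p + q) + (r + s) + (a + (a + a))) + ((u + t) + (w + k) + (a + (a + a)))))
    no-bad = solve-∀

  factor-exists : (∀ σ → IsFactor D σ → ⊥) → ⊥
  factor-exists ¬factor = swapping-exists (assume-maximal Swapping G contradict)
    where
    G : Permutation′ n → Fin n → Bool
    G σ u = arc D u (σ ⟨$⟩ʳ u)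

    contradict : ∀ σ → Swapping σ →
      (∀ τ → Swapping τ → (∀ i → T (G σ i) → T (G τ i)) → ∀ i → T (G τ i) → T (G σ i)) → ⊥
    contradict σ swapping maximal = ¬factor σ λ u → decidable-stable (u ⟶? s u) (bad-vertex u)
      where
      s : Fin n → Fin n
      s u = σ ⟨$⟩ʳ u

      bad-vertex : ∀ x → ¬ ¬ x ⟶ s x
      bad-vertex x bad = overflow 1
          -- The degree sum of `x` and `z` is at least `3 * a`, so `d⁺ D x + d⁺ D z` is at least
          -- `a`; with `d⁺ D z + d⁻ D (s x) < a` this gives `d⁻ D (s x) < d⁺ D x`.
          ((degrees x z x≢z (inj₂ (s z , x⟶sz , z-good)) ⊕ d⁻≤a x ⊕ d⁻≤a z ⊕
              d⁺+d⁻-disjoint-< {σ} swapping {z} {s x} (λ eq → swapping x (trans x≡z eq))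
                (λ v (zv , vx) → no-rotation x⟶sz zv vx) x (sym x≡z) (no-swap x⟶sz) bad)
           ⊕
           -- Dually, `s x` and `s z′` give `d⁺ D x < d⁻ D (s x)`.
           (degrees (s x) (s z′) sx≢sz′ (inj₁ (z′ , z′⟶sx , z′-good)) ⊕ d⁺≤a (s x) ⊕ d⁺≤a (s z′) ⊕
              d⁺+d⁻-disjoint-< {σ} swapping {x} {s z′} (λ eq → swapping z′ (trans (sym x≡z′) eq))
                (λ v (xv , vz′) → no-rotation xv vz′ z′⟶sx) x refl bad
                (λ xz′ → no-swap xz′ z′⟶sx)))
          (no-bad a (d⁺ D x) (d⁻ D x) (d⁺ D z) (d⁻ D z) (d⁻ D (s x)) (d⁺ D (s x)) (d⁺ D (s z′)) (d⁻ D (s z′)))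
        where
        no-swap : ∀ {v} → x ⟶ s v → ¬ v ⟶ s x
        no-swap {v} xv vx = bad (maximal (swap σ x v)
          (swap-elim σ x v (λ i j → side i ≢ side j) (crosses xv) (crosses vx) (λ u _ _ → swapping u))
          (swap-elim σ x v (λ i j → i ⟶ s i → i ⟶ j) (λ _ → xv) (λ _ → vx) (λ _ _ _ e → e))
          x (subst (x ⟶_) (sym (swap-ˡ σ x v)) xv))

        -- If `v ⟶ s v` failed as well, exchanging the images would gain an arc at `x` and lose
        -- none.
        out-good : ∀ {v} → x ⟶ s v → v ⟶ s v
        out-good {v} xv = decidable-stable (v ⟶? s v) λ v-bad → bad (maximal (swap σ x v)
          (swap-elim σ x v (λ i j → side i ≢ side j) (crosses xv)
             (λ eq → swapping x (trans (out-σ-same {σ} swapping xv) eq)) (λ u _ _ → swapping u))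
          (swap-elim σ x v (λ i j → i ⟶ s i → i ⟶ j) (λ _ → xv) (λ e → ⊥-elim (v-bad e)) (λ _ _ _ e → e))
          x (subst (x ⟶_) (sym (swap-ˡ σ x v)) xv))

        -- The exchange provides an arc at `v` and costs nothing at `x`, where the arc fails
        -- already; so maximality applies to `v`.
        in-good : ∀ {v} → v ⟶ s x → v ⟶ s v
        in-good {v} vx = maximal (swap σ x v)
          (swap-elim σ x v (λ i j → side i ≢ side j)
             (λ eq → swapping v (trans (out-σ-same {σ} swapping vx) eq)) (crosses vx) (λ u _ _ → swapping u))
          (swap-elim σ x v (λ i j → i ⟶ s i → i ⟶ j) (λ e → ⊥-elim (bad e)) (λ _ → vx) (λ _ _ _ e → e))
          v (subst (v ⟶_) (sym (swap-ʳ σ x v)) vx)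

        no-rotation : ∀ {u v} → x ⟶ s u → u ⟶ s v → ¬ v ⟶ s x
        no-rotation {u} {v} xu uv vx = bad (maximal τ
            (rotated (λ i j → side i ≢ side j) (crosses xu) (crosses uv) (crosses vx) swapping)
            (rotated (λ i j → i ⟶ s i → i ⟶ j) (λ _ → xu) (λ _ → uv) (λ _ → vx) (λ _ e → e))
            x (subst (x ⟶_) (sym (trans (swap-else τ₁ u v x≢u (v≢x ∘ sym)) (swap-ˡ σ x u))) xu))
          where
          -- `τ₁` sends `u` to `s x`; the second exchange passes `s x` on to `v` and gives `s v` to
          -- `u`.
          τ₁ = swap σ x u
          τ  = swap τ₁ u v
          x≢u : x ≢ u
          x≢u refl = bad xu
          v≢x : v ≢ x
          v≢x refl = bad vx
          v≢u : v ≢ u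
          v≢u refl = no-swap xu vx
          rotated : ∀ (P : Fin n → Fin n → Set) → P x (s u) → P u (s v) → P v (s x) →
                    (∀ w → P w (s w)) → ∀ w → P w (τ ⟨$⟩ʳ w)
          rotated P px pu pv pw = swap-elim τ₁ u v P
            (subst (P u) (sym (swap-else σ x u v≢x v≢u)) pu)
            (subst (P v) (sym (swap-ʳ σ x u)) pv)
            (λ w w≢u w≢v → swap-elim σ x u (λ i j → i ≢ u → P i j) (λ _ → px) (λ u≢u → ⊥-elim (u≢u refl))
                              (λ w _ _ _ → pw w) w w≢u)

        z = σ ⟨$⟩ˡ proj₁ (out-neighbour x)
        x⟶sz : x ⟶ s z
        x⟶sz = subst (x ⟶_) (sym (inverseʳ σ)) (proj₂ (out-neighbour x))
        z′ = proj₁ (in-neighbour (s x))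
        z′⟶sx : z′ ⟶ s x
        z′⟶sx = proj₂ (in-neighbour (s x))
        z-good = out-good x⟶sz
        z′-good = in-good z′⟶sx
        x≡z = out-σ-same {σ} swapping x⟶sz
        x≡z′ = sym (out-σ-same {σ} swapping z′⟶sx)
        x≢z : x ≢ z
        x≢z eq = bad (subst (x ⟶_) (cong s (sym eq)) x⟶sz)
        sx≢sz′ : s x ≢ s z′
        sx≢sz′ eq = bad (subst (_⟶ s x) (sym (perm-injective σ eq)) z′⟶sx)

  -- Factors with a maximal orbit relation

  Maximal : Permutation′ n → Set
  Maximal σ = ∀ τ → IsFactor D τ → (∀ {u v} → Reach σ u v → Reach τ u v) → ∀ {u v} → Reach τ u v → Reach σ u v

  maximal-factor-exists : (∀ σ → IsFactor D σ → Maximal σ → ⊥) → ⊥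
  maximal-factor-exists ¬maximal = factor-exists (assume-maximal (IsFactor D) G λ σ factor maximal →
      ¬maximal σ factor λ τ τ-factor σ⊆τ {u} {v} u~v →
        subst (λ (u , v) → Reach σ u v) (remQuot-combine u v)
          (toWitness (maximal τ τ-factor (λ i → fromWitness ∘ σ⊆τ ∘ toWitness) (combine u v)
            (fromWitness (subst (λ (u , v) → Reach τ u v) (sym (remQuot-combine u v)) u~v)))))
    where
    -- The orbit relation is a set of pairs, coded in `Fin (n * n)` to fit `assume-maximal`.
    G : Permutation′ n → Fin (n * n) → Bool
    G σ i = isYes (reach? σ (proj₁ (remQuot {n} n i)) (proj₂ (remQuot {n} n i)))

module MaximalFactor {n : ℕ} (D : Digraph n) (side : Fin n → Bool) (a : ℕ)
    (bal : BalancedBipartite D side a) (0<a : 0 < a)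
    (strong : StronglyConnected D) (degrees : DegreeCondition D a)
    (σ : Permutation′ n) (factor : IsFactor D σ)
    (maximal : Dense.Maximal D side a bal 0<a strong degrees σ)
    (¬hamiltonian : ¬ Hamiltonian D) where

  open Dense D side a bal 0<a strong degrees public

  s : Fin n → Fin n
  s u = σ ⟨$⟩ʳ u

  pr : Fin n → Fin n
  pr u = σ ⟨$⟩ˡ u

  infix 4 _~_ _~?_
  _~_ : Fin n → Fin n → Set
  u ~ v = Reach σ u v

  _~?_ : ∀ u v → Dec (u ~ v)
  _~?_ = reach? σ

  s-pr : ∀ {u} → s (pr u) ≡ u
  s-pr = inverseʳ σ

  pr⟶ : ∀ u → pr u ⟶ u
  pr⟶ u = subst (pr u ⟶_) s-pr (factor (pr u))

  ⟶s-pr : ∀ {u v} → u ⟶ v → u ⟶ s (pr v)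
  ⟶s-pr {u} = subst (u ⟶_) (sym s-pr)

  swapping : Swapping σ
  swapping u = crosses (factor u)

  side-ss : ∀ u → side u ≡ side (s (s u))
  side-ss u = ≢-≢⇒≡ (swapping u) (swapping (s u))

  side-s : ∀ {u v} → side u ≡ side v → side (s u) ≡ side (s v)
  side-s {u} {v} eq = ≢-≢⇒≡ (swapping u ∘ sym) (λ eq′ → swapping v (trans (sym eq) eq′))

  side-s′ : ∀ {u v} → side u ≢ side v → side u ≡ side (s v)
  side-s′ {u} {v} u≢v = ≢-≢⇒≡ u≢v (swapping v)

  side-pr : ∀ {u v} → side u ≢ side v → side u ≡ side (pr v)
  side-pr {u} {v} u≢v = ≢-≢⇒≡ u≢v (crosses (pr⟶ v) ∘ sym)

  ⟶-pr-same : ∀ {u v} → u ⟶ v → side u ≡ side (pr v)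
  ⟶-pr-same = side-pr ∘ crosses

  ~-s : ∀ {u v} → u ~ v → u ~ s v
  ~-s u~v = reach-trans σ u~v (reach-step σ _)

  ~-s⁻ : ∀ {u v} → u ~ s v → u ~ v
  ~-s⁻ u~sv = reach-trans σ u~sv (reach-sym σ (reach-step σ _))

  ~-pr : ∀ {u v} → u ~ v → u ~ pr v
  ~-pr u~v = reach-trans σ u~v (reach-pred σ _)

  ~-pr⁻ : ∀ {u v} → u ~ pr v → u ~ v
  ~-pr⁻ u~pv = reach-trans σ u~pv (reach-sym σ (reach-pred σ _))

  other-orbit : ∀ u → ∃ λ v → ¬ u ~ v
  other-orbit u with any? (λ v → ¬? (u ~? v))
  ... | yes v = v
  ... | no ¬v = ⊥-elim (¬hamiltonian (single-orbit⇒hamiltonian D σ factor u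
                  λ v → decidable-stable (u ~? v) λ u≁v → ¬v (v , u≁v)))

  align : ∀ w v → ∃ λ v′ → v ~ v′ × side w ≡ side v′
  align w v with side w ≟ᵇ side v
  ... | yes eq = v , reach-refl σ , eq
  ... | no neq = s v , reach-step σ v , side-s′ neq

  other-orbit-same : ∀ u → ∃ λ v → side u ≡ side v × ¬ u ~ v
  other-orbit-same u with v , u≁v ← other-orbit u with v′ , v~v′ , eq ← align u v =
    v′ , eq , λ u~v′ → u≁v (reach-trans σ u~v′ (reach-sym σ v~v′))

  -- Exchanging the images would fuse two orbits and still give a factor, against the maximality of
  -- `σ`. The factor `τ` is kept general because `reroute` applies this to a rerouted one.
  unmergeable-in : ∀ τ → IsFactor D τ → (∀ {u v} → u ~ v → Reach τ u v) →
                   ∀ {u z} → ¬ u ~ z → u ⟶ τ ⟨$⟩ʳ z → ¬ z ⟶ τ ⟨$⟩ʳ u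
  unmergeable-in τ τ-factor σ⊆τ {u} {z} u≁z uz zu with reach? τ u z
  ... | yes u~z = u≁z (maximal τ τ-factor σ⊆τ u~z)
  ... | no  u≁τz = u≁z (maximal (swap τ u z)
          (swap-elim τ u z _⟶_ uz zu (λ w _ _ → τ-factor w))
          (fuse-⊆ τ u≁τz ∘ σ⊆τ) (fuse-joins τ u≁τz))

  unmergeable : ∀ {u z} → ¬ u ~ z → u ⟶ s z → ¬ z ⟶ s u
  unmergeable = unmergeable-in σ factor id

  abstract
    peer : Fin n → Fin n → Bool
    peer x z = isYes ((side x ≟ᵇ side z) ×-dec (x ~? z))

    peer⁺ : ∀ {x z} → side x ≡ side z → x ~ z → T (peer x z)
    peer⁺ x≡z x~z = fromWitness (x≡z , x~z)

    peer⁻ : ∀ {x z} → T (peer x z) → side x ≡ side z × x ~ z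
    peer⁻ = toWitness

    orbit : Fin n → Fin n → Bool
    orbit x z = isYes (x ~? z)

    orbit⁺ : ∀ {x z} → x ~ z → T (orbit x z)
    orbit⁺ = fromWitness

    orbit⁻ : ∀ {x z} → T (orbit x z) → x ~ z
    orbit⁻ = toWitness

  m : Fin n → ℕ
  m x = #[ peer x ]

  -- Summed over an orbit, `f` and `deg D` agree, because `s` permutes the orbit; and `f` can be
  -- bounded by means of `unmergeable`.
  f : Fin n → ℕ
  f x = d⁺ D x + d⁻ D (s x)

  private
    module _ (x : Fin n) where
      out⊆ : ∀ z → x ⟶ s z → T (same x z)
      out⊆ z e = T-not-differ (out-σ-same {σ} swapping e)
      in⊆ : ∀ z → z ⟶ s x → T (same x z)
      in⊆ z e = T-not-differ (sym (out-σ-same {σ} swapping e))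
      both⊆ : ∀ z → x ⟶ s z → z ⟶ s x → T (peer x z)
      both⊆ z xz zx = peer⁺ (out-σ-same {σ} swapping xz)
        (decidable-stable (x ~? z) λ x≁z → unmergeable x≁z xz zx)

  -- Both neighbourhoods are moved to the side of `x`, which has `a` vertices; by `unmergeable` they
  -- overlap only inside the orbit of `x`.
  f-bound : ∀ x → f x ≤ a + m x
  f-bound x rewrite d⁺-σ {σ} swapping x =
    subst (λ k → _ ≤ k + m x) (#same x)
      (#-overlap {p = λ z → arc D x (s z)} {λ z → arc D z (s x)} {same x} {peer x}
        (out⊆ x) (in⊆ x) (both⊆ x))

  f-bound-< : ∀ x z → ⟦ arc D x (s z) ⟧ + ⟦ arc D z (s x) ⟧ < ⟦ same x z ⟧ + ⟦ peer x z ⟧ → f x < a + m x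
  f-bound-< x z lt rewrite d⁺-σ {σ} swapping x =
    subst (λ k → _ < k + m x) (#same x)
      (#-overlap-< {p = λ z → arc D x (s z)} {λ z → arc D z (s x)} {same x} {peer x}
        (out⊆ x) (in⊆ x) (both⊆ x) z lt)

  common-same : ∀ {x y} → CommonNeighbour D x y → side x ≡ side y
  common-same (inj₁ (z , zx , zy)) = ≢-≢⇒≡ (crosses zx ∘ sym) (crosses zy)
  common-same (inj₂ (z , xz , yz)) = ≢-≢⇒≡ (crosses xz) (crosses yz ∘ sym)

-- At least three vertices per side: lower bound on the degrees

module Large {n : ℕ} (D : Digraph n) (side : Fin n → Bool) (a : ℕ)
    (bal : BalancedBipartite D side a) (3≤a : 3 ≤ a)
    (strong : StronglyConnected D) (degrees : DegreeCondition D a)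
    (σ : Permutation′ n) (factor : IsFactor D σ)
    (maximal : Dense.Maximal D side a bal (<⇒≤ (<⇒≤ 3≤a)) strong degrees σ)
    (¬hamiltonian : ¬ Hamiltonian D) where

  open MaximalFactor D side a bal (<⇒≤ (<⇒≤ 3≤a)) strong degrees σ factor maximal ¬hamiltonian public

  -- The degree condition says nothing about such a vertex. Any other vertex has degree at least
  -- `a`, since its partner has degree at most `a + a`.
  Lonely : Fin n → Set
  Lonely u = ∀ v → u ≢ v → ¬ CommonNeighbour D u v

  private
    lonely-out-sum : ∀ a p q r t → 3 * a + (p + (q + (r + (t + 3)))) ≡ suc (0 + ((p + q) + (r + t) + (a + (1 + (a + (1 + a))))))
    lonely-out-sum = solve-∀
    lonely-in-sum : ∀ a p q r t → 3 * a + (p + (q + (r + (t + 3)))) ≡ suc (0 + ((p + q) + (r + t) + (a + (1 + (1 + (a + a))))))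
    lonely-in-sum = solve-∀
    lonely-missing-sum : ∀ a p q r t → 3 * a + (p + (q + (suc r + suc t))) ≡ suc (0 + ((p + q) + (r + t) + (a + (1 + (a + a)))))
    lonely-missing-sum = solve-∀

  module _ {u : Fin n} (lonely : Lonely u) where

    private
      in-of-out : ∀ {v w} → u ⟶ w → v ⟶ w → v ≡ u
      in-of-out {v} {w} uw vw = decidable-stable (v ≟ u) λ v≢u → lonely v (v≢u ∘ sym) (inj₂ (w , uw , vw))

      out-of-in : ∀ {v w} → w ⟶ u → w ⟶ v → v ≡ u
      out-of-in {v} {w} wu wv = decidable-stable (v ≟ u) λ v≢u → lonely v (v≢u ∘ sym) (inj₁ (w , wu , wv))

    -- Two distinct out-neighbours of `u` would have `u` as their only in-neighbour, hence degree
    -- sum at most `2 * a + 2`, less than `3 * a`.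
    lonely-out : ∀ {w} → u ⟶ w → w ≡ s u
    lonely-out {w} uw = decidable-stable (w ≟ s u) λ w≢su → overflow 0
      (degrees w (s u) w≢su (inj₁ (u , uw , factor u)) ⊕ d⁺≤a w ⊕ d⁻≤1 (in-of-out uw) ⊕
       d⁺≤a (s u) ⊕ d⁻≤1 (in-of-out (factor u)) ⊕ 3≤a)
      (lonely-out-sum a (d⁺ D w) (d⁻ D w) (d⁺ D (s u)) (d⁻ D (s u)))

    lonely-s : Lonely (s u)
    lonely-s v su≢v (inj₁ (z , zsu , zv)) =
      su≢v (sym (lonely-out (subst (_⟶ v) (in-of-out (factor u) zsu) zv)))
    lonely-s v su≢v cn@(inj₂ (z , suz , vz)) with v ⟶? u
    -- Here `d⁺ D v` is at most 1, because `u` is the only out-neighbour of its in-neighbours.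
    ... | yes vu = overflow 0
          (degrees (s u) v su≢v cn ⊕ d⁺≤a (s u) ⊕ d⁻≤1 (in-of-out (factor u)) ⊕
           d⁺≤1 (out-of-in vu) ⊕ d⁻≤a v ⊕ 3≤a)
          (lonely-in-sum a (d⁺ D (s u)) (d⁻ D (s u)) (d⁺ D v) (d⁻ D v))
    -- Here `v` lacks both arcs to and from `u`: an arc `u ⟶ v` would give `v ≡ s u`.
    ... | no ¬vu = overflow 0
          (degrees (s u) v su≢v cn ⊕ d⁺≤a (s u) ⊕ d⁻≤1 (in-of-out (factor u)) ⊕
           d⁺<a v≢u ¬vu ⊕ d⁻<a v≢u (λ uv → su≢v (sym (lonely-out uv))))
          (lonely-missing-sum a (d⁺ D (s u)) (d⁻ D (s u)) (d⁺ D v) (d⁻ D v))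
      where
      v≢u : side v ≢ side u
      v≢u eq = swapping u (trans (sym eq) (sym (common-same cn)))

  lonely-orbit : ∀ {u v} → u ~ v → Lonely u → Lonely v
  lonely-orbit (zero  , refl) l = l
  lonely-orbit (suc k , eq)   l = lonely-orbit (k , eq) (lonely-s l)

  -- Loneliness spreads along the orbit, and a lonely vertex has only its successor as
  -- out-neighbour; so no arc could leave the orbit.
  ¬lonely : ∀ {u} → ¬ Lonely u
  ¬lonely {u} l with v , u≁v ← other-orbit u
    with x , y , u~x , u≁y , xy ← star-crosses (u ~?_) (strong u v) (reach-refl σ) u≁v
    = u≁y (subst (u ~_) (sym (lonely-out (lonely-orbit u~x l) xy)) (~-s u~x))

  private
    partner-sum : ∀ a d e → 3 * a + (suc d + e) ≡ suc (0 + ((d + e) + (a + (a + a))))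
    partner-sum = solve-∀

  a≤deg : ∀ u → a ≤ deg D u
  a≤deg u = decidable-stable (a ≤? deg D u) λ a≰d → ¬lonely λ v u≢v cn →
    overflow 0 (degrees u v u≢v cn ⊕ ≰⇒> a≰d ⊕ deg≤2a v) (partner-sum a (deg D u) (deg D v))

  -- No orbit is a 2-cycle

  private
    pred-sum : ∀ a d r t → 3 * a + (suc r + (t + suc d)) ≡ suc (0 + (d + (r + t) + (a + (a + suc a))))
    pred-sum = solve-∀
    succ-sum : ∀ a d r t → 3 * a + (r + (suc t + suc d)) ≡ suc (0 + (d + (r + t) + (a + (a + suc a))))
    succ-sum = solve-∀
    two-cycle-regroup : ∀ a p q r t → (p + t) + ((r + q) + suc a) ≡ (p + q) + ((r + t) + suc a)
    two-cycle-regroup = solve-∀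
    pred-in-sum : ∀ a d r t → 3 * a + (suc r + (suc t + d)) ≡ suc (0 + (d + (r + t) + (a + (a + suc a))))
    pred-in-sum = solve-∀
    pred-out-sum : ∀ a d r t → 3 * a + (suc (r + 1) + (t + d)) ≡ suc (0 + (d + (r + t) + (a + (a + suc a))))
    pred-out-sum = solve-∀

  d⁺-two-missing : ∀ {x v w} → side x ≢ side v → side x ≢ side w → v ≢ w → ¬ x ⟶ v → ¬ x ⟶ w →
                   d⁺ D x + 1 < a
  d⁺-two-missing {x} {v} {w} x≢v x≢w v≢w ¬xv ¬xw = subst₂ (λ i j → d⁺ D x + i < j) (#-singleton w) (#opp x)
    (#-disjoint-< {p = arc D x} {⟨ w ⟩} {opp x}
       (λ u (xu , u≡w) → ¬xw (subst (x ⟶_) (⟨⟩⇒≡ u≡w) xu))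
       (λ u → T-differ ∘ crosses)
       (λ u u≡w → T-differ (subst (λ i → side x ≢ side i) (sym (⟨⟩⇒≡ u≡w)) x≢w))
       v ¬xv (v≢w ∘ ⟨⟩⇒≡) (T-differ x≢v))

  two-cycle-orbit : ∀ {x v} → s (s x) ≡ x → x ~ v → v ≡ x ⊎ v ≡ s x
  two-cycle-orbit {x} ssx≡x (k , refl) = go k
    where
    go : ∀ k → iter σ k x ≡ x ⊎ iter σ k x ≡ s x
    go zero = inj₁ refl
    go (suc k) with go k
    ... | inj₁ eq = inj₂ (trans (iter-suc σ k x) (cong s eq))
    ... | inj₂ eq = inj₁ (trans (iter-suc σ k x) (trans (cong s eq) ssx≡x))

  module _ {x : Fin n} (ssx≡x : s (s x) ≡ x) where

    two-cycle-f : f x ≤ suc a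
    two-cycle-f = ≤-trans (f-bound x) (≤-trans (≤-refl ⊕ m≤1) (≤-reflexive (+-comm a 1)))
      where
      m≤1 : m x ≤ 1
      m≤1 = subst (m x ≤_) (#-singleton x) (#-mono {p = peer x} {⟨ x ⟩} λ z pz → ∈⟨⟩ (peer≡ (peer⁻ pz)))
        where
        peer≡ : ∀ {z} → side x ≡ side z × x ~ z → z ≡ x
        peer≡ (eq , x~z) with two-cycle-orbit ssx≡x x~z
        ... | inj₁ z≡x  = z≡x
        ... | inj₂ refl = ⊥-elim (swapping x eq)

    private
      y = s x

    pred-off : ∀ {v} → x ⟶ v → v ≢ y → ¬ x ~ pr v
    pred-off {v} xv v≢y x~pv with two-cycle-orbit ssx≡x x~pv
    ... | inj₁ pv≡x = v≢y (trans (sym s-pr) (cong s pv≡x))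
    ... | inj₂ pv≡y = crosses xv (cong side (sym (trans (sym s-pr) (trans (cong s pv≡y) ssx≡x))))

    pred↛ : ∀ {v} → x ⟶ v → v ≢ y → ¬ pr v ⟶ y
    pred↛ xv v≢y = unmergeable (pred-off xv v≢y) (⟶s-pr xv)

    pred-degree : ∀ {v} → x ⟶ v → v ≢ y → 3 * a ≤ deg D x + deg D (pr v)
    pred-degree {v} xv v≢y = degrees x (pr v) (λ eq → pred-off xv v≢y (subst (x ~_) eq (reach-refl σ)))
      (inj₂ (v , xv , pr⟶ v))

    -- Suppose the degree is at most `a`. An out-neighbour `v` other than `y` would force degree
    -- `2 * a` on `pr v`, although `pr v ⟶ y` fails; dually for in-neighbours. With neither, the
    -- degree is at most 2, against `a≤deg`.
    two-cycle-deg : suc a ≤ deg D x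
    two-cycle-deg = decidable-stable (suc a ≤? deg D x) λ d≤a → contra (s≤s (≤-pred (≰⇒> d≤a)))
      where
      contra : deg D x < suc a → ⊥
      contra d<1+a with any? (λ v → (x ⟶? v) ×-dec ¬? (v ≟ y))
      ... | yes (v , xv , v≢y) = overflow 0
            (pred-degree xv v≢y ⊕ d⁺<a (λ eq → swapping x (trans (⟶-pr-same xv) eq)) (pred↛ xv v≢y) ⊕ d⁻≤a (pr v) ⊕ d<1+a)
            (pred-sum a (deg D x) (d⁺ D (pr v)) (d⁻ D (pr v)))
      ... | no ¬out with any? (λ v → (v ⟶? x) ×-dec ¬? (v ≟ y))
      ...   | yes (v , vx , v≢y) = overflow 0
              (degrees x (s v) x≢sv (inj₁ (v , vx , factor v)) ⊕ d⁺≤a (s v) ⊕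
               d⁻<a (λ eq → swapping x (trans x≡sv eq))
                    (λ ysv → unmergeable {v} {y} v≁y (subst (v ⟶_) (sym ssx≡x) vx) ysv) ⊕ d<1+a)
              (succ-sum a (deg D x) (d⁺ D (s v)) (d⁻ D (s v)))
        where
        x≡sv : side x ≡ side (s v)
        x≡sv = side-s′ (crosses vx ∘ sym)
        x≢sv : x ≢ s v
        x≢sv eq = v≢y (perm-injective σ (trans (sym eq) (sym ssx≡x)))
        v≁y : ¬ v ~ y
        v≁y v~y with two-cycle-orbit ssx≡x (reach-trans σ (reach-step σ x) (reach-sym σ v~y))
        ... | inj₁ refl = crosses vx refl
        ... | inj₂ v≡y  = v≢y v≡y
      ...   | no ¬in = <-irrefl refl (≤-trans 3≤a (≤-trans (a≤deg x)
                (d⁺≤1 {w = y} (λ {v} xv → decidable-stable (v ≟ y) λ v≢y → ¬out (v , xv , v≢y)) ⊕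
                 d⁻≤1 {w = y} (λ {v} vx → decidable-stable (v ≟ y) λ v≢y → ¬in (v , vx , v≢y)))))

  module _ {x : Fin n} (ssx≡x : s (s x) ≡ x) where

    private
      y = s x
      ssy≡y : s (s y) ≡ y
      ssy≡y = cong s ssx≡x

    -- On the 2-cycle `f x + f y` is `deg D x + deg D y`; both values of `f` are at most `suc a`,
    -- and `deg D y` is at least `suc a`.
    two-cycle-deg′ : deg D x ≤ suc a
    two-cycle-deg′ = +-cancelʳ-≤ (deg D y + suc a) (deg D x) (suc a)
      (subst₂ _≤_ (two-cycle-regroup a (d⁺ D x) (d⁻ D x) (d⁺ D y) (d⁻ D y)) (cong (suc a +_) (+-comm (suc a) (deg D y)))
        (two-cycle-f ssx≡x ⊕ subst (λ w → d⁺ D y + d⁻ D w ≤ suc a) ssx≡x (two-cycle-f ssy≡y) ⊕ two-cycle-deg ssy≡y))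

    -- The degree condition on x and pr v leaves room for a single missing arc at pr v, namely pr v ⟶ y.
    module _ {v : Fin n} (xv : x ⟶ v) (v≢y : v ≢ y) where

      private
        pv≢y : side (pr v) ≢ side y
        pv≢y eq = swapping x (trans (⟶-pr-same xv) eq)

      pred-full-in : ∀ {w} → side (pr v) ≢ side w → w ⟶ pr v
      pred-full-in {w} pv≢w = decidable-stable (w ⟶? pr v) λ ¬w → overflow 0
        (pred-degree ssx≡x xv v≢y ⊕ d⁺<a pv≢y (pred↛ ssx≡x xv v≢y) ⊕ d⁻<a pv≢w ¬w ⊕ two-cycle-deg′)
        (pred-in-sum a (deg D x) (d⁺ D (pr v)) (d⁻ D (pr v)))

      pred-full-out : ∀ {w} → side (pr v) ≢ side w → w ≢ y → pr v ⟶ w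
      pred-full-out {w} pv≢w w≢y = decidable-stable (pr v ⟶? w) λ ¬w → overflow 0
        (pred-degree ssx≡x xv v≢y ⊕ d⁺-two-missing pv≢y pv≢w (w≢y ∘ sym) (pred↛ ssx≡x xv v≢y) ¬w ⊕ d⁻≤a (pr v) ⊕ two-cycle-deg′)
        (pred-out-sum a (deg D x) (d⁺ D (pr v)) (d⁻ D (pr v)))

  -- An arc leaves the 2-cycle towards `v`; then the whole orbit of `v` is dominated and sends no
  -- arc back. So the arc `w ⟶ d` that enters the 2-cycle starts on a third orbit, and this one
  -- merges with the orbit of `v`.
  no-two-cycle : ∀ x → s (s x) ≢ x
  no-two-cycle x ssx≡x
    with o , x≁o ← other-orbit x
    with c , v , x~c , x≁v , cv ← star-crosses (x ~?_) (strong x o) (reach-refl σ) x≁o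
    with w , d , x≁w , ¬x≁d , wd ← star-crosses (λ u → ¬? (x ~? u)) (strong o x) x≁o (λ x≁x → x≁x (reach-refl σ))
    with v′ , v~v′ , w≡v′ ← align w v
    = unmergeable {v′} {w} v′≁w
        (full-out v′-dom (subst (_≢ side (s w)) w≡v′ (swapping w)) (x≁w ∘ ~-s⁻))
        (full-in (dominated-orbit (~-s v~v′) v-dom) (subst (λ b → side (s v′) ≢ b) (sym w≡v′) (swapping v′ ∘ sym)))
    where
    in-cycle : ∀ {c} → x ~ c → s (s c) ≡ c
    in-cycle x~c with two-cycle-orbit ssx≡x x~c
    ... | inj₁ refl = ssx≡x
    ... | inj₂ refl = cong s ssx≡x

    Dominated : Fin n → Set
    Dominated v = ¬ x ~ v × ∃ λ c → x ~ c × c ⟶ v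

    not-succ : ∀ {v c} → ¬ x ~ v → x ~ c → v ≢ s c
    not-succ x≁v x~c refl = x≁v (~-s x~c)

    -- `pred-full-in` gives `pr v` every possible in-arc, among them one from `s c`; so domination
    -- moves backwards along the orbit.
    dominated-pred : ∀ {v} → Dominated v → Dominated (pr v)
    dominated-pred (x≁v , c , x~c , cv) = x≁v ∘ ~-pr⁻ , s c , ~-s x~c ,
      pred-full-in (in-cycle x~c) cv (not-succ x≁v x~c) (λ eq → swapping c (trans (⟶-pr-same cv) eq))

    dominated-orbit : ∀ {v w} → v ~ w → Dominated v → Dominated w
    dominated-orbit v~w = go (reach-sym σ v~w)
      where
      go : ∀ {v w} → w ~ v → Dominated v → Dominated w
      go (zero  , refl)     dom = dom
      go {v} {w} (suc k , eq) dom = subst Dominated (inverseˡ σ) (dominated-pred (go (k , eq) dom))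

    full-in : ∀ {v w} → Dominated v → side v ≢ side w → w ⟶ v
    -- What is known of predecessors carries over to `v`, because `v` is `pr (s v)` and `s v` is
    -- dominated too.
    full-in {v} {w} dom v≢w with x≁sv , c , x~c , csv ← dominated-orbit (reach-step σ v) dom =
      subst (w ⟶_) (inverseˡ σ) (pred-full-in (in-cycle x~c) csv (not-succ x≁sv x~c)
        (subst (λ u → side u ≢ side w) (sym (inverseˡ σ)) v≢w))

    full-out : ∀ {v w} → Dominated v → side v ≢ side w → ¬ x ~ w → v ⟶ w
    full-out {v} {w} dom v≢w x≁w with x≁sv , c , x~c , csv ← dominated-orbit (reach-step σ v) dom =
      subst (_⟶ w) (inverseˡ σ) (pred-full-out (in-cycle x~c) csv (not-succ x≁sv x~c)
        (subst (λ u → side u ≢ side w) (sym (inverseˡ σ)) v≢w) (not-succ x≁w x~c))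

    no-return : ∀ {v d} → Dominated v → x ~ d → ¬ v ⟶ d
    no-return {v} {d} dom x~d vd with x≁sv , c , x~c , csv ← dominated-orbit (reach-step σ v) dom
      with two-cycle-orbit (in-cycle x~c) (reach-trans σ (reach-sym σ x~c) x~d)
    ... | inj₁ refl = crosses vd (sym (subst (λ u → side c ≡ side u) (inverseˡ σ) (⟶-pr-same csv)))
    ... | inj₂ refl = pred↛ (in-cycle x~c) csv (not-succ x≁sv x~c) (subst (_⟶ s c) (sym (inverseˡ σ)) vd)

    v-dom : Dominated v
    v-dom = x≁v , c , x~c , cv
    v′-dom : Dominated v′
    v′-dom = dominated-orbit v~v′ v-dom
    v′≁w : ¬ v′ ~ w
    v′≁w v′~w = no-return (dominated-orbit v′~w v′-dom) (decidable-stable (x ~? d) ¬x≁d) wd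

  -- Vertices on the same side have a common neighbour

  private
    disjoint-regroup : ∀ a p q r t → (p + r) + ((q + t) + a) ≡ (p + q) + ((r + t) + a)
    disjoint-regroup = solve-∀
    disjoint-cover-sum : ∀ a p q r t → suc (p + r) + ((q + t) + (a + a)) ≡ suc (0 + (a + (a + ((p + q) + (r + t)))))
    disjoint-cover-sum = solve-∀
    full-degree-sum : ∀ a p q → 3 * a + (suc p + q) ≡ suc (0 + ((p + q + a) + (a + a)))
    full-degree-sum = solve-∀

  module _ {u₁ u₂ : Fin n} (u₁≡u₂ : side u₁ ≡ side u₂) (¬common : ¬ CommonNeighbour D u₁ u₂) where

    private
      out-disjoint : ∀ v → ¬ (u₁ ⟶ v × u₂ ⟶ v)
      out-disjoint v e = ¬common (inj₂ (v , e))

      in-disjoint : ∀ v → ¬ (v ⟶ u₁ × v ⟶ u₂)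
      in-disjoint v e = ¬common (inj₁ (v , e))

    -- The degree sum of `u₁` and `u₂` is at most `a + a`, and `deg D u₂` is at least `a`.
    disjoint-deg : deg D u₁ ≤ a
    disjoint-deg = +-cancelʳ-≤ (deg D u₂ + a) (deg D u₁) a
      (subst₂ _≤_ (disjoint-regroup a (d⁺ D u₁) (d⁻ D u₁) (d⁺ D u₂) (d⁻ D u₂)) (cong (a +_) (+-comm a (deg D u₂)))
        (d⁺-disjoint u₁≡u₂ out-disjoint ⊕ d⁻-disjoint u₁≡u₂ in-disjoint ⊕ a≤deg u₂))

    disjoint-covers : ∀ {v} → side u₁ ≢ side v → ¬ u₁ ⟶ v → u₂ ⟶ v
    disjoint-covers {v} u₁≢v ¬u₁v = decidable-stable (u₂ ⟶? v) λ ¬u₂v → overflow 0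
      (d⁺-disjoint-< u₁≡u₂ out-disjoint v u₁≢v ¬u₁v ¬u₂v ⊕ d⁻-disjoint u₁≡u₂ in-disjoint ⊕ a≤deg u₁ ⊕ a≤deg u₂)
      (disjoint-cover-sum a (d⁺ D u₁) (d⁻ D u₁) (d⁺ D u₂) (d⁻ D u₂))

  common-sym : ∀ {x y} → CommonNeighbour D x y → CommonNeighbour D y x
  common-sym (inj₁ (z , zx , zy)) = inj₁ (z , zy , zx)
  common-sym (inj₂ (z , xz , yz)) = inj₂ (z , yz , xz)

  -- Two vertices u₁, u₂ without a common neighbour split the neighbourhoods of the other side between them,
  -- so every third vertex on their side has full degree, and the orbit of u₁ or u₂ is a 2-cycle.
  same-side⇒common : ∀ {u₁ u₂} → side u₁ ≡ side u₂ → ¬ ¬ CommonNeighbour D u₁ u₂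
  same-side⇒common {u₁} {u₂} u₁≡u₂ ¬common =
    let u , u₁≡u , u≢u₁ , u≢u₂ = third in contradict u₁≡u u≢u₁ u≢u₂
    where
    ¬common′ : ¬ CommonNeighbour D u₂ u₁
    ¬common′ = ¬common ∘ common-sym

    module _ {u : Fin n} (u₁≡u : side u₁ ≡ side u) (u≢u₁ : u ≢ u₁) (u≢u₂ : u ≢ u₂) where

      full-degree : 3 * a ≤ deg D u + a
      -- `s u` is an out-neighbour of `u₁` or of `u₂`, and both have degree at most `a`.
      full-degree with u₁ ⟶? s u
      ... | yes e = ≤-trans (degrees u u₁ u≢u₁ (inj₂ (s u , factor u , e)))
                      (+-monoʳ-≤ (deg D u) (disjoint-deg u₁≡u₂ ¬common))
      ... | no ¬e = ≤-trans (degrees u u₂ u≢u₂ (inj₂ (s u , factor u ,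
                        disjoint-covers u₁≡u₂ ¬common (λ eq → swapping u (trans (sym u₁≡u) eq)) ¬e)))
                      (+-monoʳ-≤ (deg D u) (disjoint-deg (sym u₁≡u₂) ¬common′))

      full-out : ∀ {w} → side u ≢ side w → u ⟶ w
      full-out {w} u≢w = decidable-stable (u ⟶? w) λ ¬e → overflow 0
        (full-degree ⊕ d⁺<a u≢w ¬e ⊕ d⁻≤a u) (full-degree-sum a (d⁺ D u) (d⁻ D u))

    third : ∃ λ u → side u₁ ≡ side u × u ≢ u₁ × u ≢ u₂
    third with any? (λ u → (side u₁ ≟ᵇ side u) ×-dec (¬? (u ≟ u₁) ×-dec ¬? (u ≟ u₂)))
    ... | yes u = u
    ... | no ¬u = ⊥-elim (1+n≰n (≤-trans 3≤a (subst₂ _≤_ (#same u₁) (cong₂ _+_ (#-singleton u₁) (#-singleton u₂))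
                    (#-cover {r = same u₁} {⟨ u₁ ⟩} {⟨ u₂ ⟩} λ v s → either v (not-differ⇒≡ s)))))
      where
      either : ∀ v → side u₁ ≡ side v → T (⟨ u₁ ⟩ v) ⊎ T (⟨ u₂ ⟩ v)
      either v eq with v ≟ u₁ | v ≟ u₂
      ... | yes _  | _      = inj₁ _
      ... | no _   | yes _  = inj₂ _
      ... | no v≢u₁ | no v≢u₂ = ⊥-elim (¬u (v , eq , v≢u₁ , v≢u₂))

    module _ {u : Fin n} (u₁≡u : side u₁ ≡ side u) (u≢u₁ : u ≢ u₁) (u≢u₂ : u ≢ u₂) where

      full-out-s : ∀ {z} → side u ≡ side z → u ⟶ s z
      full-out-s {z} u≡z = full-out u₁≡u u≢u₁ u≢u₂ (λ eq → swapping z (trans (sym u≡z) eq))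

      off-orbit : ∀ {z} → side u ≡ side z → ¬ u ~ z → z ≡ u₁ ⊎ z ≡ u₂
      off-orbit {z} u≡z u≁z with z ≟ u₁ | z ≟ u₂
      ... | yes eq  | _       = inj₁ eq
      ... | no _    | yes eq  = inj₂ eq
      -- Such a `z` has all its out-arcs too, so both arcs of a merge with `u` are present.
      ... | no z≢u₁ | no z≢u₂ = ⊥-elim (unmergeable u≁z (full-out-s u≡z)
              (full-out (trans u₁≡u u≡z) z≢u₁ z≢u₂ (λ eq → swapping u (trans u≡z eq))))

      close : ∀ {z z′} → side u ≡ side z → side z ≡ side z′ → ¬ CommonNeighbour D z z′ →
              s (s z) ≡ z ⊎ s (s z) ≡ z′ → u ~ z
      close {z} {z′} u≡z z≡z′ ¬cn (inj₁ eq)   = ⊥-elim (no-two-cycle z eq)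
      -- If `u` and `z` were on different orbits, `z ⟶ s u` would fail, so `z′ ⟶ s u` would hold and
      -- merge `u` with `z′`, which lies on the orbit of `z`.
      close {z} {z′} u≡z z≡z′ ¬cn (inj₂ ssz≡z′) = decidable-stable (u ~? z) λ u≁z →
        unmergeable (λ u~z′ → u≁z (~-s⁻ (~-s⁻ (subst (u ~_) (sym ssz≡z′) u~z′))))
          (full-out-s (trans u≡z z≡z′))
          (disjoint-covers z≡z′ ¬cn (λ eq → swapping u (trans u≡z eq)) (unmergeable u≁z (full-out-s u≡z)))

      contradict : ⊥
      contradict = let z , u≡z , u≁z = other-orbit-same u in go u≡z u≁z (off-orbit u≡z u≁z)
          (off-orbit (trans u≡z (side-ss z)) (u≁z ∘ ~-s⁻ ∘ ~-s⁻))
        where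
        go : ∀ {z} → side u ≡ side z → ¬ u ~ z → z ≡ u₁ ⊎ z ≡ u₂ → s (s z) ≡ u₁ ⊎ s (s z) ≡ u₂ → ⊥
        go u≡z u≁z (inj₁ refl) ssz         = u≁z (close u≡z u₁≡u₂ ¬common ssz)
        go u≡z u≁z (inj₂ refl) (inj₁ ssz≡) = u≁z (close u≡z (sym u₁≡u₂) ¬common′ (inj₂ ssz≡))
        go u≡z u≁z (inj₂ refl) (inj₂ ssz≡) = u≁z (close u≡z (sym u₁≡u₂) ¬common′ (inj₁ ssz≡))

  ore : ∀ {u v} → u ≢ v → side u ≡ side v → 3 * a ≤ deg D u + deg D v
  ore {u} {v} u≢v u≡v = decidable-stable (3 * a ≤? deg D u + deg D v) λ small →
    same-side⇒common u≡v (small ∘ degrees u v u≢v)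

  -- Half-size orbits

  module _ (u : Fin n) where

    private
      ∈C : Fin n → Bool
      ∈C = orbit u

      S : (Fin n → ℕ) → ℕ
      S g = sum (λ v → ⟦ ∈C v ⟧ * g v)

      S-+ : ∀ g h → S (λ v → g v + h v) ≡ S g + S h
      S-+ g h = trans (sum-cong-≗ (λ v → *-distribˡ-+ ⟦ ∈C v ⟧ (g v) (h v)))
                      (∑-distrib-+ (λ v → ⟦ ∈C v ⟧ * g v) (λ v → ⟦ ∈C v ⟧ * h v))

      S-s : ∀ g → S (g ∘ s) ≡ S g
      S-s g = trans (sum-cong-≗ (λ v → cong (λ b → ⟦ b ⟧ * g (s v)) (∈C-s v)))
                    (sym (sum-permute (λ v → ⟦ ∈C v ⟧ * g v) σ))
        where
        ∈C-s : ∀ v → ∈C v ≡ ∈C (s v)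
        ∈C-s v = T-ext (orbit⁺ ∘ ~-s ∘ orbit⁻) (orbit⁺ ∘ ~-s⁻ ∘ orbit⁻)

      S-f : S f ≡ S (deg D)
      S-f = trans (S-+ (d⁺ D) (d⁻ D ∘ s)) (trans (cong (S (d⁺ D) +_) (S-s (d⁻ D))) (sym (S-+ (d⁺ D) (d⁻ D))))

      S-ore : S (λ _ → 3 * a) ≤ S f + S f
      S-ore = subst (S (λ _ → 3 * a) ≤_)
        (trans (S-+ (deg D) (deg D ∘ s ∘ s))
          (cong₂ _+_ (sym S-f) (trans (S-s (deg D ∘ s)) (trans (S-s (deg D)) (sym S-f)))))
        (sum-mono-≤ λ v → ⟦⟧*-mono-≤ {∈C v} λ _ → ore (no-two-cycle v ∘ sym) (side-ss v))

    -- `v` and `s (s v)` are distinct, so their degree sum is at least `3 * a`. Summed over the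
    -- orbit, this makes the average of `f v + f v` at least `3 * a`, and an upper bound `3 * a` is
    -- attained everywhere.
    average : (∀ {v} → u ~ v → f v + f v ≤ 3 * a) → ∀ {v} → u ~ v → ¬ f v + f v < 3 * a
    average bound {v} u~v lt = <-irrefl refl (≤-trans (subst (_< S (λ _ → 3 * a)) (S-+ f f)
      (sum-mono-< (λ w → ⟦⟧*-mono-≤ {∈C w} (bound ∘ orbit⁻)) v (⟦⟧*-mono-< {∈C v} (orbit⁺ u~v) lt))) S-ore)

  m-s : ∀ x → m (s x) ≤ m x
  m-s x = subst (_≤ m x) (sym (#-permute (peer (s x)) σ))
    (#-mono {p = λ z → peer (s x) (s z)} {peer x} λ z p → let eq , sx~sz = peer⁻ p in
      peer⁺ (trans (side-ss x) (trans (side-s eq) (sym (side-ss z)))) (reach-trans σ (reach-step σ x) (~-s⁻ sx~sz)))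

  m-orbit : ∀ {x v} → x ~ v → m v ≤ m x
  m-orbit (zero  , refl) = ≤-refl
  m-orbit {x} (suc k , eq) = ≤-trans (m-orbit (k , eq)) (m-s x)

  Half : Fin n → Set
  Half x = m x + m x ≤ a

  half-orbit : ∀ {x v} → x ~ v → Half x → Half v
  half-orbit x~v = ≤-trans (m-orbit x~v ⊕ m-orbit x~v)

  private
    double-regroup : ∀ a k → a + k + (a + k) ≡ k + k + (a + a)
    double-regroup = solve-∀
    a+[a+a]≡3*a : ∀ a → a + (a + a) ≡ 3 * a
    a+[a+a]≡3*a = solve-∀

    double : ∀ {k} → k + k ≤ a → a + k + (a + k) ≤ 3 * a
    double {k} h = subst₂ _≤_ (sym (double-regroup a k)) (a+[a+a]≡3*a a) (h ⊕ ≤-refl)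

    double-< : ∀ {k} → k + k < a → a + k + (a + k) < 3 * a
    double-< {k} h = subst₂ _≤_ (cong suc (sym (double-regroup a k))) (a+[a+a]≡3*a a) (h ⊕ ≤-refl)

  module _ {x : Fin n} (half : Half x) where

    private
      bound : ∀ {v} → x ~ v → f v + f v ≤ 3 * a
      bound {v} x~v = ≤-trans (f-bound v ⊕ f-bound v) (double (half-orbit x~v half))

    half-tight : ∀ {v} → x ~ v → ¬ f v < a + m v
    half-tight {v} x~v lt = average x bound x~v (<-≤-trans (+-mono-<-≤ lt (<⇒≤ lt)) (double (half-orbit x~v half)))

    half-≥ : a ≤ m x + m x
    half-≥ = decidable-stable (a ≤? m x + m x) λ a≰2m → average x bound (reach-refl σ)
      (≤-<-trans (f-bound x ⊕ f-bound x) (double-< (≰⇒> a≰2m)))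

    -- Without this arc, `z` would count twice on the right of `f-bound` and at most once on the
    -- left.
    half-complete : ∀ {v z} → x ~ v → v ~ z → side v ≡ side z → v ⟶ s z
    half-complete {v} {z} x~v v~z v≡z = decidable-stable (v ⟶? s z) λ ¬e → half-tight x~v
      (f-bound-< v z (⟦⟧-overlap-<ˡ {q = arc D z (s v)} ¬e (T-not-differ v≡z) (peer⁺ v≡z v~z)))

    -- If both arcs failed, `z` would count on the right of `f-bound` only.
    half-cover : ∀ {v z} → x ~ v → side v ≡ side z → ¬ z ⟶ s v → v ⟶ s z
    half-cover {v} {z} x~v v≡z ¬e = decidable-stable (v ⟶? s z) λ ¬e′ → half-tight x~v
      (f-bound-< v z (⟦⟧-overlap-< {t = peer v z} ¬e′ ¬e (T-not-differ v≡z)))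

  -- The orbit of x induces a complete bipartite digraph, so its cycle can be rerouted through x ⟶ s x′.
  reroute : ∀ {x x′ z} → Half x → x ~ x′ → side x ≡ side x′ → side x ≡ side z → ¬ x ~ z →
            x ⟶ s z → ¬ z ⟶ s x′
  reroute {x} {x′} {z} half x~x′ x≡x′ x≡z x≁z xz zx′ with x ≟ x′
  ... | yes refl = unmergeable x≁z xz zx′
  ... | no x≢x′ = go
    where
    y = s x
    q = s x′
    -- `x` now goes to `s x′`, at the risk of cutting the cycle in two.
    τ₁ = swap σ x x′

    off : ∀ {w} → side x ≢ side w → w ≢ x × w ≢ x′
    off x≢w = (λ { refl → x≢w refl }) , λ { refl → x≢w x≡x′ }

    x≢y : side x ≢ side y
    x≢y = swapping x
    x≢q : side x ≢ side q
    x≢q eq = swapping x′ (trans (sym x≡x′) eq)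
    y≡q : side y ≡ side q
    y≡q = side-s x≡x′
    y~q : y ~ q
    y~q = reach-trans σ (reach-sym σ (reach-step σ x)) (~-s x~x′)

    τ₁y : τ₁ ⟨$⟩ʳ y ≡ s y
    τ₁y = swap-else σ x x′ (proj₁ (off x≢y)) (proj₂ (off x≢y))
    τ₁q : τ₁ ⟨$⟩ʳ q ≡ s q
    τ₁q = swap-else σ x x′ (proj₁ (off x≢q)) (proj₂ (off x≢q))
    τ₁z : τ₁ ⟨$⟩ʳ z ≡ s z
    τ₁z = swap-else σ x x′ (λ { refl → x≁z (reach-refl σ) }) (λ { refl → x≁z x~x′ })

    τ₁-factor : IsFactor D τ₁
    τ₁-factor = swap-elim σ x x′ _⟶_ (half-complete half (reach-refl σ) x~x′ x≡x′)
      (half-complete half x~x′ (reach-sym σ x~x′) (sym x≡x′)) (λ u _ _ → factor u)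

    finish : ∀ τ → IsFactor D τ → (∀ {u v} → Reach τ₁ u v → Reach τ u v) → Reach τ y q →
             τ ⟨$⟩ʳ x ≡ q → τ ⟨$⟩ʳ z ≡ s z → ⊥
    finish τ τ-factor τ₁⊆τ y~τq τx τz =
      unmergeable-in τ τ-factor (reach-⊆ σ {τ} step) x≁z (subst (x ⟶_) (sym τz) xz) (subst (z ⟶_) (sym τx) zx′)
      where
      step : ∀ u → Reach τ u (s u)
      step u = cases (u ≟ x) (u ≟ x′)
        where
        cases : Dec (u ≡ x) → Dec (u ≡ x′) → Reach τ u (s u)
        cases (yes refl) _          = reach-trans τ (τ₁⊆τ (1 , swap-ˡ σ x x′)) (reach-sym τ y~τq)
        cases (no _)     (yes refl) = reach-trans τ (τ₁⊆τ (1 , swap-ʳ σ x x′)) y~τq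
        cases (no u≢x)   (no u≢x′)  = τ₁⊆τ (1 , swap-else σ x x′ u≢x u≢x′)

    go : ⊥
    go with reach? τ₁ y q
    ... | yes y~τq = finish τ₁ τ₁-factor id y~τq (swap-ˡ σ x x′) τ₁z
    -- Completeness of the orbit allows a second exchange, at `y` and `q`, which rejoins the pieces.
    ... | no  y≁τq = finish (swap τ₁ y q)
          (swap-elim τ₁ y q _⟶_
            (subst (y ⟶_) (sym τ₁q) (half-complete half (reach-step σ x) y~q y≡q))
            (subst (q ⟶_) (sym τ₁y) (half-complete half (~-s x~x′) (reach-sym σ y~q) (sym y≡q)))
            (λ u _ _ → τ₁-factor u))
          (fuse-⊆ τ₁ y≁τq) (fuse-joins τ₁ y≁τq)
          (trans (swap-else τ₁ y q (λ eq → x≢y (cong side eq)) (λ eq → x≢q (cong side eq))) (swap-ˡ σ x x′))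
          (trans (swap-else τ₁ y q (λ eq → x≢y (trans x≡z (cong side eq))) (λ eq → x≢q (trans x≡z (cong side eq)))) τ₁z)

  -- Two halves and the arcs between them

  private
    two-orbits-sum : ∀ a k l → suc (k + l) + (suc (k + l) + (a + a)) ≡ suc (1 + (a + (a + ((k + k) + (l + l)))))
    two-orbits-sum = solve-∀

  module _ {x z : Fin n} (x≡z : side x ≡ side z) (x≁z : ¬ x ~ z) where

    private
      peers-disjoint : ∀ v → ¬ (T (peer x v) × T (peer z v))
      peers-disjoint v (xv , zv) = x≁z (reach-trans σ (proj₂ (peer⁻ xv)) (reach-sym σ (proj₂ (peer⁻ zv))))
      x-peers : ∀ v → T (peer x v) → T (same x v)
      x-peers v xv = T-not-differ (proj₁ (peer⁻ xv))
      z-peers : ∀ v → T (peer z v) → T (same x v)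
      z-peers v zv = T-not-differ (trans x≡z (proj₁ (peer⁻ zv)))

      m+m≤a : m x + m z ≤ a
      m+m≤a = subst (m x + m z ≤_) (#same x) (#-disjoint {p = peer x} {peer z} {same x} peers-disjoint x-peers z-peers)

    -- The orbit with fewer vertices on this side is half-size; by `half-≥` it has at least half of
    -- the `a` vertices, which leaves at most half for the other.
    halves : Half x × Half z
    halves with ≤-total (m x) (m z)
    ... | inj₁ mx≤mz = half , ≤-trans (+-cancelˡ-≤ (m x) (m z) (m x) (≤-trans m+m≤a (half-≥ half)) ⊕ ≤-refl) m+m≤a
      where
      half : Half x
      half = ≤-trans (≤-refl ⊕ mx≤mz) m+m≤a
    ... | inj₂ mz≤mx = ≤-trans (≤-refl ⊕ +-cancelʳ-≤ (m z) (m x) (m z) (≤-trans m+m≤a (half-≥ half))) m+m≤a , half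
      where
      half : Half z
      half = ≤-trans (mz≤mx ⊕ ≤-refl) m+m≤a

    two-orbits : ∀ v → ¬ x ~ v → z ~ v
    two-orbits v x≁v with v′ , v~v′ , x≡v′ ← align x v = decidable-stable (z ~? v) λ z≁v →
      let lt = subst (m x + m z <_) (#same x) (#-disjoint-< {p = peer x} {peer z} {same x} peers-disjoint x-peers z-peers v′
                 (λ p → x≁v (reach-trans σ (proj₂ (peer⁻ p)) (reach-sym σ v~v′)))
                 (λ p → z≁v (reach-trans σ (proj₂ (peer⁻ p)) (reach-sym σ v~v′)))
                 (T-not-differ x≡v′))
      in overflow 1 (lt ⊕ lt ⊕ half-≥ (proj₁ halves) ⊕ half-≥ (proj₂ halves)) (two-orbits-sum a (m x) (m z))

    -- `reroute` excludes `z ⟶ s x′`, so `half-cover` yields `x′ ⟶ s z`. A second `reroute`, in the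
    -- orbit of `z′`, turns this against `z′ ⟶ s x′`.
    one-way : x ⟶ s z → ∀ {x′ z′} → x ~ x′ → z ~ z′ → side x ≡ side x′ → side x ≡ side z′ → ¬ z′ ⟶ s x′
    one-way xz {x′} {z′} x~x′ z~z′ x≡x′ x≡z′ z′x′ =
      reroute {z′} {z} {x′} (half-orbit z~z′ (proj₂ halves)) (reach-sym σ z~z′) (trans (sym x≡z′) x≡z) (trans (sym x≡z′) x≡x′)
        (λ z′~x′ → x≁z (reach-trans σ x~x′ (reach-sym σ (reach-trans σ z~z′ z′~x′)))) z′x′
        (half-cover (proj₁ halves) x~x′ (trans (sym x≡x′) x≡z)
          (reroute (proj₁ halves) x~x′ x≡x′ x≡z x≁z xz))

  private
    ore-sum : ∀ a → 3 * a + 3 ≡ suc (2 + (a + a + a))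
    ore-sum = solve-∀

  module _ {x z c v t r : Fin n} (x≡z : side x ≡ side z) (x≁z : ¬ x ~ z)
           (x~c : x ~ c) (x≁v : ¬ x ~ v) (cv : c ⟶ v)
           (z~t : z ~ t) (z≁r : ¬ z ~ r) (tr : t ⟶ r) where

    private
      z~v : z ~ v
      z~v = two-orbits x≡z x≁z v x≁v
      x~r : x ~ r
      x~r = two-orbits (sym x≡z) (x≁z ∘ reach-sym σ) r z≁r

      join : ∀ {o u w} → o ~ u → o ~ w → u ~ w
      join o~u o~w = reach-trans σ (reach-sym σ o~u) o~w

      apart : ∀ {u w} → x ~ u → z ~ w → ¬ u ~ w
      apart x~u z~w u~w = x≁z (reach-trans σ x~u (reach-trans σ u~w (reach-sym σ z~w)))

      no-enter : ∀ {w b} → z ~ w → x ~ b → side c ≡ side w → ¬ w ⟶ b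
      no-enter z~w x~b c≡w wb = one-way (⟶-pr-same cv) (apart x~c (~-pr z~v)) (⟶s-pr cv)
        (join x~c (~-pr x~b)) (join (~-pr z~v) z~w) (trans c≡w (⟶-pr-same wb)) c≡w (⟶s-pr wb)

      no-leave : ∀ {b w} → x ~ b → z ~ w → side t ≡ side b → ¬ b ⟶ w
      no-leave x~b z~w t≡b bw = one-way (⟶-pr-same tr) (apart (~-pr x~r) z~t ∘ reach-sym σ) (⟶s-pr tr)
        (join z~t (~-pr z~w)) (join (~-pr x~r) x~b) (trans t≡b (⟶-pr-same bw)) t≡b (⟶s-pr bw)

    -- If `c` and `t` are on the same side, `t ⟶ r` contradicts `one-way`. Otherwise the vertices of
    -- the orbit of `x` on the side of `t` have all their neighbours inside that orbit, hence degree
    -- at most `a`, and two of them violate `ore`.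
    crossing-arcs : ⊥
    crossing-arcs with side c ≟ᵇ side t
    ... | yes c≡t = no-enter z~t x~r c≡t tr
    ... | no c≢t = overflow 2
        (≤-trans (ore (no-two-cycle (s c) ∘ sym) (side-ss (s c)))
           (low (~-s x~c) t≡sc ⊕ low (~-s (~-s (~-s x~c))) (trans t≡sc (side-ss (s c)))) ⊕ 3≤a)
        (ore-sum a)
      where
      t≡sc : side t ≡ side (s c)
      t≡sc = side-s′ (c≢t ∘ sym)

      low : ∀ {b} → x ~ b → side t ≡ side b → deg D b ≤ a
      low {b} x~b t≡b = ≤-trans
          (≤-trans (#-mono {p = arc D b} {peer (s b)} out) (m-orbit (~-s x~b)) ⊕
           ≤-trans (#-mono {p = λ w → arc D w b} {peer (s b)} in′) (m-orbit (~-s x~b)))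
          (proj₁ (halves x≡z x≁z))
        where
        out : ∀ w → b ⟶ w → T (peer (s b) w)
        out w bw = peer⁺ (≢-≢⇒≡ (swapping b ∘ sym) (crosses bw)) (join (~-s x~b)
          (decidable-stable (x ~? w) λ x≁w → no-leave x~b (two-orbits x≡z x≁z w x≁w) t≡b bw))
        in′ : ∀ w → w ⟶ b → T (peer (s b) w)
        in′ w wb = peer⁺ (≢-≢⇒≡ (swapping b ∘ sym) (crosses wb ∘ sym)) (join (~-s x~b)
          (decidable-stable (x ~? w) λ x≁w → no-enter (two-orbits x≡z x≁z w x≁w) x~b
             (≢-≢⇒≡ c≢t (λ eq → crosses wb (trans (sym eq) t≡b))) wb))

  impossible : ⊥
  impossible =
    let x , _             = #-nonempty side (subst (0 <_) (sym (proj₁ (proj₂ bal))) (<⇒≤ (<⇒≤ 3≤a)))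
        z , x≡z , x≁z     = other-orbit-same x
        _ , _ , x~c , x≁v , cv = star-crosses (x ~?_) (strong x z) (reach-refl σ) x≁z
        _ , _ , z~t , z≁r , tr = star-crosses (z ~?_) (strong z x) (reach-refl σ) (x≁z ∘ reach-sym σ)
    in crossing-arcs x≡z x≁z x~c x≁v cv z~t z≁r tr

-- Order four

private
  K : Digraph 4
  K = K22-minus-2cycle

module _ {n : ℕ} {D : Digraph n} (iso : Isomorphic D K) where

  private
    φ = proj₁ iso
    injective = proj₁ (proj₁ (proj₂ iso))
    surjective = proj₂ (proj₁ (proj₂ iso))
    arc≡ = proj₂ (proj₂ iso)

    ψ : Fin 4 → Fin n
    ψ j = proj₁ (surjective j)

    φψ : ∀ j → φ (ψ j) ≡ j
    φψ j = proj₂ (surjective j) refl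

    ψφ : ∀ v → ψ (φ v) ≡ v
    ψφ v = injective (φψ (φ v))

    π : Permutation n 4
    π = permutation φ ψ φψ ψφ

    -- All paths are routed through 3; only 2 needs the detour by 1.
    K-strong : StronglyConnected K
    K-strong u v = to u ◅◅ from v
      where
      to : ∀ u → Star (λ x y → T (arc K x y)) u 3F
      to 0F = _ ◅ ε
      to 1F = _ ◅ ε
      to 2F = _◅_ {j = 1F} _ (_ ◅ ε)
      to 3F = ε
      from : ∀ v → Star (λ x y → T (arc K x y)) 3F v
      from 0F = _ ◅ ε
      from 1F = _ ◅ ε
      from 2F = _◅_ {j = 1F} _ (_ ◅ ε)
      from 3F = ε

    K-degrees : DegreeCondition K 2
    K-degrees = toWitness {a? = all? λ x → all? λ y → ¬? (x ≟ y) →-dec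
      (((any? λ z → T? (arc K z x) ×-dec T? (arc K z y)) ⊎-dec (any? λ z → T? (arc K x z) ×-dec T? (arc K y z)))
        →-dec (6 ≤? deg K x + deg K y))} _

    φ-arc : ∀ {x y} → T (arc D x y) → T (arc K (φ x) (φ y))
    φ-arc {x} {y} = subst T (arc≡ x y)

    φ-deg : ∀ x → deg D x ≡ deg K (φ x)
    φ-deg x = cong₂ _+_
      (trans (#-cong (arc≡ x)) (sym (#-permute (arc K (φ x)) π)))
      (trans (#-cong (λ u → arc≡ u x)) (sym (#-permute (λ u → arc K u (φ x)) π)))

    φ-common : ∀ {x y} → CommonNeighbour D x y → CommonNeighbour K (φ x) (φ y)
    φ-common (inj₁ (z , zx , zy)) = inj₁ (φ z , φ-arc zx , φ-arc zy)
    φ-common (inj₂ (z , xz , yz)) = inj₂ (φ z , φ-arc xz , φ-arc yz)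

  iso⇒strong : StronglyConnected D
  iso⇒strong u v = subst₂ (Star (λ x y → T (arc D x y))) (ψφ u) (ψφ v)
    (gmap ψ (λ {i} {j} → subst T (sym (trans (arc≡ (ψ i) (ψ j)) (cong₂ (arc K) (φψ i) (φψ j))))) (K-strong (φ u) (φ v)))

  iso⇒degrees : DegreeCondition D 2
  iso⇒degrees x y x≢y cn = subst (6 ≤_) (sym (cong₂ _+_ (φ-deg x) (φ-deg y)))
    (K-degrees (φ x) (φ y) (x≢y ∘ injective) (φ-common cn))

-- In K the vertex 0 has 3 as its only neighbour, so it cannot lie on a cycle of length four.
iso⇒¬hamiltonian : ∀ {n} {D : Digraph n} → Isomorphic D K → ¬ Hamiltonian D
iso⇒¬hamiltonian {n} {D} (φ , (φ-inj , φ-surj) , arc≡) (c , (c-inj , c-surj) , arcs) = go n≡4 c-inj arcs i φci≡0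
  where
  n≡4 : n ≡ 4
  n≡4 = ↔⇒≡ (permutation φ (λ j → proj₁ (φ-surj j)) (λ j → proj₂ (φ-surj j) refl)
           (λ v → φ-inj (proj₂ (φ-surj (φ v)) refl)))
  v = proj₁ (φ-surj 0F)
  i = proj₁ (c-surj v)
  φci≡0 : φ (c i) ≡ 0F
  φci≡0 = trans (cong φ (proj₂ (c-surj v) refl)) (proj₂ (φ-surj 0F) refl)

  out : ∀ {w} → T (arc K 0F w) → w ≡ 3F
  out {3F} _ = refl
  into : ∀ {w} → T (arc K w 0F) → w ≡ 3F
  into {3F} _ = refl

  -- Only the number of indices is specialised to 4, so that `cycle` can run through them; the
  -- vertices remain in `Fin n`.
  go : ∀ {m} {d : Fin m → Fin n} → m ≡ 4 → Injective _≡_ _≡_ d →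
       (∀ i j → (suc (toℕ i) ≡ toℕ j ⊎ (suc (toℕ i) ≡ m × toℕ j ≡ 0)) → T (arc D (d i) (d j))) →
       ∀ i → φ (d i) ≢ 0F
  go {d = d} refl d-inj d-arcs i φdi≡0 = cycle i φdi≡0
    where
    next≡prev : ∀ {i j k} → φ (d i) ≡ 0F → T (arc D (d i) (d j)) → T (arc D (d k) (d i)) → j ≡ k
    next≡prev {i} {j} {k} eq ij ki = d-inj (φ-inj (trans
      (out (subst (λ w → T (arc K w (φ (d j)))) eq (subst T (arc≡ (d i) (d j)) ij)))
      (sym (into (subst (λ w → T (arc K (φ (d k)) w)) eq (subst T (arc≡ (d k) (d i)) ki))))))
    cycle : ∀ i → φ (d i) ≢ 0F
    cycle 0F eq with () ← next≡prev {0F} {1F} {3F} eq (d-arcs 0F 1F (inj₁ refl)) (d-arcs 3F 0F (inj₂ (refl , refl)))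
    cycle 1F eq with () ← next≡prev {1F} {2F} {0F} eq (d-arcs 1F 2F (inj₁ refl)) (d-arcs 0F 1F (inj₁ refl))
    cycle 2F eq with () ← next≡prev {2F} {3F} {1F} eq (d-arcs 2F 3F (inj₁ refl)) (d-arcs 1F 2F (inj₁ refl))
    cycle 3F eq with () ← next≡prev {3F} {0F} {2F} eq (d-arcs 3F 0F (inj₂ (refl , refl))) (d-arcs 2F 3F (inj₁ refl))

isomorphic? : ∀ {m n} (D : Digraph m) (E : Digraph n) → Dec (Isomorphic D E)
isomorphic? {m} D E = any-function? m
  (λ f≗g (bij , arcs) → bijective-resp f≗g bij , λ x y → trans (arcs x y) (cong₂ (arc E) (f≗g x) (f≗g y)))
  (λ f → bijective? f ×-dec all? λ x → all? λ y → arc D x y ≟ᵇ arc E (f x) (f y))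

module _ {n : ℕ} (D : Digraph n) (side : Fin n → Bool) (a : ℕ) (bal : BalancedBipartite D side a) where

  open Bipartite D side a bal

  -- `K` is the path 0, 3, 1, 2 with each edge replaced by a 2-cycle.
  path⇒iso : (g : Fin 4 → Fin n) → (∀ v → ∃ λ i → g i ≡ v) →
    g 0F ⟶ g 3F → g 3F ⟶ g 0F → g 3F ⟶ g 1F → g 1F ⟶ g 3F → g 1F ⟶ g 2F → g 2F ⟶ g 1F →
    ¬ g 0F ⟶ g 2F → ¬ g 2F ⟶ g 0F → Isomorphic D K
  path⇒iso g cover e₀₃ e₃₀ e₃₁ e₁₃ e₁₂ e₂₁ ¬e₀₂ ¬e₂₀ = φ , (φ-injective , φ-surjective) , arcs
    where
    φ : Fin n → Fin 4
    φ v = proj₁ (cover v)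
    gφ : ∀ v → g (φ v) ≡ v
    gφ v = proj₂ (cover v)

    t : ∀ {b} → T b → b ≡ true
    t {true} _ = refl
    f : ∀ {b} → ¬ T b → b ≡ false
    f {true}  ¬b = ⊥-elim (¬b _)
    f {false} _  = refl
    g₀≡g₁ : side (g 0F) ≡ side (g 1F)
    g₀≡g₁ = ≢-≢⇒≡ (crosses e₀₃) (crosses e₃₁)
    g₂≡g₃ : side (g 2F) ≡ side (g 3F)
    g₂≡g₃ = ≢-≢⇒≡ (crosses e₂₁) (crosses e₁₃)

    arc-g : ∀ i j → arc D (g i) (g j) ≡ arc K i j
    arc-g 0F 0F = f λ e → crosses e refl
    arc-g 0F 1F = f λ e → crosses e g₀≡g₁
    arc-g 0F 2F = f ¬e₀₂
    arc-g 0F 3F = t e₀₃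
    arc-g 1F 0F = f λ e → crosses e (sym g₀≡g₁)
    arc-g 1F 1F = f λ e → crosses e refl
    arc-g 1F 2F = t e₁₂
    arc-g 1F 3F = t e₁₃
    arc-g 2F 0F = f ¬e₂₀
    arc-g 2F 1F = t e₂₁
    arc-g 2F 2F = f λ e → crosses e refl
    arc-g 2F 3F = f λ e → crosses e g₂≡g₃
    arc-g 3F 0F = t e₃₀
    arc-g 3F 1F = t e₃₁
    arc-g 3F 2F = f λ e → crosses e (sym g₂≡g₃)
    arc-g 3F 3F = f λ e → crosses e refl

    -- The vertices of `K` have distinct out-neighbourhoods, so `g` is injective once it respects
    -- arcs.
    K-out-injective : ∀ i j → (∀ k → arc K i k ≡ arc K j k) → i ≡ j
    K-out-injective = toWitness {a? = all? λ i → all? λ j → (all? λ k → arc K i k ≟ᵇ arc K j k) →-dec (i ≟ j)} _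

    g-injective : ∀ {i j} → g i ≡ g j → i ≡ j
    g-injective {i} {j} eq = K-out-injective i j λ k →
      trans (sym (arc-g i k)) (trans (cong (λ v → arc D v (g k)) eq) (arc-g j k))

    φ-injective : Injective _≡_ _≡_ φ
    φ-injective {u} {v} eq = trans (sym (gφ u)) (trans (cong g eq) (gφ v))

    φ-surjective : Surjective _≡_ _≡_ φ
    φ-surjective i = g i , λ { refl → g-injective (gφ (g i)) }

    arcs : ∀ u v → arc D u v ≡ arc K (φ u) (φ v)
    arcs u v = trans (sym (cong₂ (arc D) (gφ u) (gφ v))) (arc-g (φ u) (φ v))

module OrderFour {n : ℕ} (D : Digraph n) (side : Fin n → Bool)
    (bal : BalancedBipartite D side 2)
    (strong : StronglyConnected D) (degrees : DegreeCondition D 2)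
    (σ : Permutation′ n) (factor : IsFactor D σ)
    (maximal : Dense.Maximal D side 2 bal (s≤s z≤n) strong degrees σ)
    (¬hamiltonian : ¬ Hamiltonian D) where

  open MaximalFactor D side 2 bal (s≤s z≤n) strong degrees σ factor maximal ¬hamiltonian

  module _ {x z : Fin n} (x≡z : side x ≡ side z) (x≁z : ¬ x ~ z) where

    same-side : ∀ {w} → side x ≡ side w → w ≡ x ⊎ w ≡ z
    same-side {w} x≡w with w ≟ x | w ≟ z
    ... | yes w≡x | _       = inj₁ w≡x
    ... | no _    | yes w≡z = inj₂ w≡z
    ... | no w≢x  | no w≢z  = ⊥-elim (<-irrefl refl (subst₂ _<_ (cong₂ _+_ (#-singleton x) (#-singleton z)) (#same x)
            (#-disjoint-< {p = ⟨ x ⟩} {⟨ z ⟩} {same x}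
              (λ v (v≡x , v≡z) → x≁z (0 , trans (sym (⟨⟩⇒≡ {v = v} v≡x)) (⟨⟩⇒≡ v≡z)))
              (λ v v≡x → T-not-differ (cong side (sym (⟨⟩⇒≡ v≡x))))
              (λ v v≡z → T-not-differ (trans x≡z (cong side (sym (⟨⟩⇒≡ v≡z)))))
              w (w≢x ∘ ⟨⟩⇒≡) (w≢z ∘ ⟨⟩⇒≡) (T-not-differ x≡w))))

    ss≡ : s (s x) ≡ x
    ss≡ with same-side (side-ss x)
    ... | inj₁ eq = eq
    ... | inj₂ eq = ⊥-elim (x≁z (subst (x ~_) eq (~-s (~-s (reach-refl σ)))))

  module _ {x z : Fin n} (x≡z : side x ≡ side z) (x≁z : ¬ x ~ z) where

    private
      z≁x : ¬ z ~ x
      z≁x = x≁z ∘ reach-sym σ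
      ssx : s (s x) ≡ x
      ssx = ss≡ x≡z x≁z
      ssz : s (s z) ≡ z
      ssz = ss≡ (sym x≡z) z≁x

    data Position : Fin n → Set where
      at-x  : Position x
      at-z  : Position z
      at-sx : Position (s x)
      at-sz : Position (s z)

    position : ∀ w → Position w
    position w with side x ≟ᵇ side w
    ... | yes x≡w with same-side x≡z x≁z x≡w
    ...   | inj₁ refl = at-x
    ...   | inj₂ refl = at-z
    position w | no x≢w with same-side x≡z x≁z (side-s′ x≢w)
    ...   | inj₁ sw≡x = subst Position (perm-injective σ (trans ssx (sym sw≡x))) at-sx
    ...   | inj₂ sw≡z = subst Position (perm-injective σ (trans ssz (sym sw≡z))) at-sz

    leaves : ∀ {c v} → x ~ c → ¬ x ~ v → c ⟶ v → x ⟶ s z ⊎ s x ⟶ z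
    leaves {c} {v} x~c x≁v cv with position c | position v
    ... | at-z  | _     = ⊥-elim (x≁z x~c)
    ... | at-sz | _     = ⊥-elim (x≁z (~-s⁻ x~c))
    ... | _     | at-x  = ⊥-elim (x≁v (reach-refl σ))
    ... | _     | at-sx = ⊥-elim (x≁v (reach-step σ x))
    ... | at-x  | at-z  = ⊥-elim (crosses cv x≡z)
    ... | at-x  | at-sz = inj₁ cv
    ... | at-sx | at-z  = inj₂ cv
    ... | at-sx | at-sz = ⊥-elim (crosses cv (side-s x≡z))

  exceptional : ¬ Isomorphic D K → ⊥
  exceptional ¬iso =
    let x , _         = #-nonempty side (subst (0 <_) (sym (proj₁ (proj₂ bal))) (s≤s z≤n))
        z , x≡z , x≁z = other-orbit-same x
        z≁x           = x≁z ∘ reach-sym σ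
        _ , _ , x~c , x≁v , cv = star-crosses (x ~?_) (strong x z) (reach-refl σ) x≁z
        _ , _ , z~t , z≁r , tr = star-crosses (z ~?_) (strong z x) (reach-refl σ) z≁x
    in go x≡z x≁z (leaves x≡z x≁z x~c x≁v cv) (leaves (sym x≡z) z≁x z~t z≁r tr)
    where
    build : ∀ {x z} → side x ≡ side z → ¬ x ~ z → x ⟶ s z → s z ⟶ x → ⊥
    build {x} {z} x≡z x≁z x⟶sz sz⟶x = ¬iso (path⇒iso D side 2 bal g cover
        (subst (s x ⟶_) ssx (factor (s x))) (factor x) x⟶sz sz⟶x (subst (s z ⟶_) ssz (factor (s z))) (factor z)
        -- An arc `s x ⟶ z` would merge the orbits together with `s z ⟶ x`, and `z ⟶ s x` together
        -- with `x ⟶ s z`.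
        (λ sx⟶z → unmergeable sx≁sz (subst (s x ⟶_) (sym ssz) sx⟶z) (subst (s z ⟶_) (sym ssx) sz⟶x))
        (unmergeable x≁z x⟶sz))
      where
      ssx : s (s x) ≡ x
      ssx = ss≡ x≡z x≁z
      ssz : s (s z) ≡ z
      ssz = ss≡ (sym x≡z) (x≁z ∘ reach-sym σ)
      sx≁sz : ¬ s x ~ s z
      sx≁sz sx~sz = x≁z (~-s⁻ (reach-trans σ (reach-step σ x) sx~sz))
      g : Fin 4 → Fin n
      g 0F = s x
      g 1F = s z
      g 2F = z
      g 3F = x
      cover : ∀ v → ∃ λ i → g i ≡ v
      cover v with position x≡z x≁z v
      ... | at-x  = 3F , refl
      ... | at-z  = 2F , refl
      ... | at-sx = 0F , refl
      ... | at-sz = 1F , refl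

    -- One arc leaves the 2-cycle of `x` and one enters it. If they join the same two vertices, `D`
    -- is the exceptional digraph; otherwise the orbits merge.
    go : ∀ {x z} → side x ≡ side z → ¬ x ~ z → x ⟶ s z ⊎ s x ⟶ z → z ⟶ s x ⊎ s z ⟶ x → ⊥
    go x≡z x≁z (inj₁ x⟶sz) (inj₁ z⟶sx) = unmergeable x≁z x⟶sz z⟶sx
    go x≡z x≁z (inj₁ x⟶sz) (inj₂ sz⟶x) = build x≡z x≁z x⟶sz sz⟶x
    go x≡z x≁z (inj₂ sx⟶z) (inj₁ z⟶sx) = build (sym x≡z) (x≁z ∘ reach-sym σ) z⟶sx sx⟶z
    go {x} {z} x≡z x≁z (inj₂ sx⟶z) (inj₂ sz⟶x) = unmergeable
      (λ sx~sz → x≁z (~-s⁻ (reach-trans σ (reach-step σ x) sx~sz)))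
      (subst (s x ⟶_) (sym (ss≡ (sym x≡z) (x≁z ∘ reach-sym σ))) sx⟶z)
      (subst (s z ⟶_) (sym (ss≡ x≡z x≁z)) sz⟶x)

theorem1p2 : ((a n : ℕ) (D : Digraph n) (side : Fin n → Bool) →
    3 ≤ a → BalancedBipartite D side a → StronglyConnected D →
    DegreeCondition D a → Hamiltonian D)
    ×
    ((n : ℕ) (D : Digraph n) (side : Fin n → Bool) → BalancedBipartite D side 2 →
    ((StronglyConnected D × DegreeCondition D 2 × ¬ Hamiltonian D)
    ⇔ Isomorphic D K22-minus-2cycle))
theorem1p2 =
  -- Hamiltonicity is decidable, so the doubly negated existence of a maximal factor suffices.
  (λ a n D side 3≤a bal strong degrees → decidable-stable (hamiltonian? D) λ ¬hamiltonian →
     Dense.maximal-factor-exists D side a bal (<⇒≤ (<⇒≤ 3≤a)) strong degrees λ σ factor maximal →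
     Large.impossible D side a bal 3≤a strong degrees σ factor maximal ¬hamiltonian) ,
  λ n D side bal → mk⇔
    (λ (strong , degrees , ¬hamiltonian) → decidable-stable (isomorphic? D K22-minus-2cycle) λ ¬iso →
       Dense.maximal-factor-exists D side 2 bal (s≤s z≤n) strong degrees λ σ factor maximal →
       OrderFour.exceptional D side bal strong degrees σ factor maximal ¬hamiltonian ¬iso)
    (λ iso → iso⇒strong {D = D} iso , iso⇒degrees {D = D} iso , iso⇒¬hamiltonian {D = D} iso)
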